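{- The policy iteration algorithm RMDP-PI for Problem DiscRMDP (with discount factor $\gamma$, on a robust Markov decision process with $n$ states and $m$ actions) requires $$O\!\left(n\,m\,\frac{\log(1-\gamma)}{\log\gamma}\right)$$ (i.e., strongly polynomial for constant discount factor) iterations and solutions of Problem DiscRMC, for any compact uncertainty sets.
   Context: A robust Markov decision process (RMDP) is a tuple $\mathcal R=(\mathcal S,c,\mathcal A,\mathrm{Succ},\mathcal P)$ with finite state set $\mathcal S$ ($|\mathcal S|=n$), finite action set $\mathcal A$ ($|\mathcal A|=m$), cost $c:\mathcal S\to\mathbb R$, successor map $\mathrm{Succ}:\mathcal S\times\mathcal A\to 2^{\mathcal S}$, and for each $(s,a)$ a non-empty compact uncertainty set $\mathcal P(s,a)\subseteq\Delta(\mathrm{Succ}(s,a))$ of probability distributions. At each step in state $s$, the agent picks an action $a$, then the adversary, seeing $a$, picks $\mathfrak p\in\mathcal P(s,a)$, and the next state is drawn from $\mathfrak p$. The cost of a run $s_0,a_0,s_1,\dots$ is $\sum_{t\ge0}\gamma^t c(s_t)$; the agent minimizes and the adversary maximizes its expectation. Positional policies suffice for both: an agent policy is $\sigma:\mathcal S\to\mathcal A$, an adversary policy is $\tau:\mathcal S\times\mathcal A\to\Delta(\mathcal S)$ with $\tau(s,a)\in\mathcal P(s,a)$. The value is $v^*(s)=\inf_\sigma\sup_\tau\mathbb E_s^{\sigma,\tau}[\sum_t\gamma^tc(s_t)]$. An agent policy $\sigma^*$ is optimal if $\sup_\tau\mathbb E_s^{\sigma^*,\tau}[\sum_t\gamma^tc(s_t)]=v^*(s)$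 for every state $s$; optimal adversary policies are defined analogously. A robust Markov chain (RMC) is an RMDP with a single action (dropped from the notation, so the uncertainty sets are $\mathcal P(s)$). Problem DiscRMDP: given an RMDP with a constant discount factor $\gamma\in[0,1)$, compute the value vector $v^*$, an optimal agent policy and an optimal adversary policy. Problem DiscRMC: given an RMC with a constant discount factor $\gamma\in[0,1)$, compute the value vector and an optimal adversary policy. Algorithm RMDP-PI: start with an arbitrary agent policy $\sigma^0$, $t=0$. Repeat: (i) let $\tau^t$ be the adversary policy returned by an oracle for Problem DiscRMC on the RMC $\mathcal R^{\sigma^t}$ obtained by fixing $\sigma^t$; (ii) $v^t=(I-\gamma P^{\sigma^t,\tau^t})^{ -1}c$, where $P^{\sigma,\tau}$ is the transition matrix induced by $\sigma,\tau$; (iii) $t\leftarrow t+1$; (iv) for all $s\in\mathcal S$, $\sigma^t(s)\leftarrow\arg\min_{a\in\mathcal A}\max_{\mathfrak p\in\mathcal P(s,a)}\{c(s)+\gamma\,\mathfrak p^\top v^{t-1}\}$; until $\sigma^t=\sigma^{t-1}$. Return $\sigma^t$. An algorithm is strongly polynomial if both the number of arithmetic operations it performs and the size of intermediate values are bounded by a polynomial in the input size, independent of the numerical values of the coefficients.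
   Formalization: The ratio log(1-γ)/log γ is replaced by its maximum with 1, since it tends to 0 as γ→0 (undefined at γ=0) while at least one iteration is always made; ties in arg min are broken by a fixed rule depending on the state and the minimised objective, as otherwise the loop may never stop. -}

module Defs where

open import Level using (0ℓ)
open import Algebra.Bundles using (CommutativeRing)
open import Data.Fin.Base using (Fin; toℕ)
import Data.Fin.Properties as Finₚ
open import Data.Fin.Subset using (Subset; _∉_)
open import Data.List.Base using (List)
open import Data.List.Relation.Unary.Any using (Any)
open import Data.Nat.Base as ℕ using (ℕ; suc)
open import Data.Product.Base using (∃; _×_)
open import Relation.Binary.Bundles using (StrictTotalOrder; DecTotalOrder)
open import Relation.Binary.Core using (Rel)
open import Relation.Binary.PropositionalEquality.Core using (_≡_; _≗_)
open import Relation.Binary.Structures using (IsStrictTotalOrder)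
open import Relation.Nullary.Decidable.Core using (yes; no)
open import Relation.Nullary.Negation.Core using (¬_)
open import Relation.Unary using (Pred)

-- The inverse is total, with an unspecified value at 0.
record OrderedField : Set₁ where
  infix  4 _<_
  infixl 7 _/_
  infix  9 _⁻¹

  field
    commutativeRing : CommutativeRing 0ℓ 0ℓ

  open CommutativeRing commutativeRing public

  field
    _<_                : Rel Carrier 0ℓ
    isStrictTotalOrder : IsStrictTotalOrder _≈_ _<_
    0<1                : 0# < 1#
    +-monoʳ-<          : ∀ x {y z} → y < z → x + y < x + z
    *-pos              : ∀ {x y} → 0# < x → 0# < y → 0# < x * y
    _⁻¹                : Carrier → Carrier
    ⁻¹-inverse         : ∀ x → ¬ (x ≈ 0#) → x * x ⁻¹ ≈ 1#

  strictTotalOrder : StrictTotalOrder 0ℓ 0ℓ 0ℓ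
  strictTotalOrder = record { isStrictTotalOrder = isStrictTotalOrder }

  open import Relation.Binary.Properties.StrictTotalOrder strictTotalOrder public
    using (decTotalOrder)
  open DecTotalOrder decTotalOrder public
    using (_≤_; _≤?_; totalOrder)
  open IsStrictTotalOrder isStrictTotalOrder public
    using (compare; _≟_)

  IsSup : Pred Carrier 0ℓ → Carrier → Set
  IsSup A x = (∀ y → A y → y ≤ x) × (∀ u → (∀ y → A y → y ≤ u) → x ≤ u)

  IsInf : Pred Carrier 0ℓ → Carrier → Set
  IsInf A x = (∀ y → A y → x ≤ y) × (∀ l → (∀ y → A y → l ≤ y) → l ≤ x)

  IsMax : Pred Carrier 0ℓ → Carrier → Set
  IsMax A x = A x × (∀ y → A y → y ≤ x)

  open import Algebra.Properties.Semiring.Exp semiring public using (_^_)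
  open import Algebra.Properties.Semiring.Sum semiring public using (sum)
  open import Algebra.Properties.Monoid.Mult +-monoid public
    using () renaming (_×_ to _·_)
  open import Algebra.Construct.NaturalChoice.Max totalOrder public using (_⊔_)

  _/_ : Carrier → Carrier → Carrier
  x / y = x * y ⁻¹

  fromℕ : ℕ → Carrier
  fromℕ k = k · 1#

  -- ∣ x - y ∣ < ε
  Close : Carrier → Rel Carrier 0ℓ
  Close ε x y = (x < y + ε) × (y < x + ε)

  ConvergesTo : (ℕ → Carrier) → Carrier → Set
  ConvergesTo f x =
    ∀ ε → 0# < ε → ∃ λ N → ∀ k → N ℕ.≤ k → Close ε (f k) x

-- The real numbers, up to isomorphism: a Dedekind-complete ordered field.
record RealNumbers : Set₁ where
  field
    orderedField : OrderedField

  open OrderedField orderedField public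

  field
    complete : ∀ (A : Pred Carrier 0ℓ) → ∃ A →
               (∃ λ u → ∀ y → A y → y ≤ u) → ∃ (IsSup A)

-- A logarithm to some base greater than 1. The value on non-positive arguments
-- is unspecified, and quotients of logarithms do not depend on the base.
record Logarithm (ℝ : RealNumbers) : Set where
  open RealNumbers ℝ
  field
    log        : Carrier → Carrier
    log-cong   : ∀ {x y} → 0# < x → x ≈ y → log x ≈ log y
    log-*      : ∀ {x y} → 0# < x → 0# < y → log (x * y) ≈ log x + log y
    log-mono-< : ∀ {x y} → 0# < x → x < y → log x < log y

  -- log (1 - γ) / log γ for γ ∈ (0,1), extended to γ = 0 by its limit. It is at
  -- least 1 exactly when γ ≥ 1/2 and tends to 0 with γ, so that a bound on a
  -- positive number of iterations uniform in γ has to use 1# ⊔ logRatio γ.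
  logRatio : Carrier → Carrier
  logRatio γ with γ ≟ 0#
  ... | yes _ = 0#
  ... | no  _ = log (1# - γ) / log γ

module _ (ℝ : RealNumbers) where
  open RealNumbers ℝ

  ℝ^ : ℕ → Set
  ℝ^ n = Fin n → Carrier

  Matrix : ℕ → Set
  Matrix n = Fin n → ℝ^ n

  infix  4 _≈ᵛ_
  infixr 7 _*ᵛ_

  _≈ᵛ_ : ∀ {n} → Rel (ℝ^ n) 0ℓ
  x ≈ᵛ y = ∀ i → x i ≈ y i

  dot : ∀ {n} → ℝ^ n → ℝ^ n → Carrier
  dot x y = sum (λ i → x i * y i)

  _*ᵛ_ : ∀ {n} → Matrix n → ℝ^ n → ℝ^ n
  (M *ᵛ x) i = dot (M i) x

  _*ᴹ_ : ∀ {n} → Matrix n → Matrix n → Matrix n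
  (M *ᴹ N) i k = sum (λ j → M i j * N j k)

  identity : ∀ {n} → Matrix n
  identity i j with i Finₚ.≟ j
  ... | yes _ = 1#
  ... | no  _ = 0#

  IsInverse : ∀ {n} → Matrix n → Matrix n → Set
  IsInverse M N = (∀ i → (M *ᴹ N) i ≈ᵛ identity i) × (∀ i → (N *ᴹ M) i ≈ᵛ identity i)

  -- I - γ P
  resolvent : ∀ {n} → Carrier → Matrix n → Matrix n
  resolvent γ P i j = identity i j - γ * P i j

  Open : ∀ {n} → Pred (ℝ^ n) 0ℓ → Set
  Open U = ∀ x → U x → ∃ λ ε → (0# < ε) × (∀ y → (∀ i → Close ε (x i) (y i)) → U y)

  Compact : ∀ {n} → Pred (ℝ^ n) 0ℓ → Set₁
  Compact {n} K =
    ∀ (I : Set) (U : I → Pred (ℝ^ n) 0ℓ) → (∀ i → Open (U i)) →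
    (∀ x → K x → ∃ λ i → U i x) →
    ∃ λ (is : List I) → ∀ x → K x → Any (λ i → U i x) is

  -- Probability distributions on Fin n supported on X.
  record Δ {n} (X : Subset n) (p : ℝ^ n) : Set where
    field
      nonNegative : ∀ i → 0# ≤ p i
      total       : sum p ≈ 1#
      support     : ∀ i → i ∉ X → p i ≈ 0#

  record RMDP (n m : ℕ) : Set₁ where
    field
      cost       : ℝ^ n
      Succ       : Fin n → Fin m → Subset n
      𝒫          : Fin n → Fin m → Pred (ℝ^ n) 0ℓ
      𝒫-resp-≈   : ∀ s a {p q} → p ≈ᵛ q → 𝒫 s a p → 𝒫 s a q
      𝒫⊆Δ        : ∀ s a p → 𝒫 s a p → Δ (Succ s a) p
      𝒫-nonempty : ∀ s a → ∃ (𝒫 s a)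
      𝒫-compact  : ∀ s a → Compact (𝒫 s a)

  RMC : ℕ → Set₁
  RMC n = RMDP n 1

  AgentPolicy : ℕ → ℕ → Set
  AgentPolicy n m = Fin n → Fin m

  record AdversaryPolicy {n m} (R : RMDP n m) : Set where
    open RMDP R
    field
      choice  : Fin n → Fin m → ℝ^ n
      allowed : ∀ s a → 𝒫 s a (choice s a)

  transition : ∀ {n m} {R : RMDP n m} → AgentPolicy n m → AdversaryPolicy R → Matrix n
  transition σ τ s = AdversaryPolicy.choice τ s (σ s)

  -- E_s[c(s_t)] in the Markov chain with transition matrix P, that is (P^t c)(s).
  expectedCostAt : ∀ {n} → Matrix n → ℝ^ n → ℕ → ℝ^ n
  expectedCostAt P c ℕ.zero  = c
  expectedCostAt P c (suc t) = P *ᵛ expectedCostAt P c t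

  -- The expectation of the discounted cost of a run, as the limit of the
  -- expected discounted costs of its finite prefixes.
  ExpectedCost : ∀ {n m} (γ : Carrier) (R : RMDP n m) →
                 AgentPolicy n m → AdversaryPolicy R → Fin n → Pred Carrier 0ℓ
  ExpectedCost γ R σ τ s = ConvergesTo λ N →
    sum {N} λ t → γ ^ toℕ t * expectedCostAt (transition σ τ) (RMDP.cost R) (toℕ t) s

  module _ {n m : ℕ} (γ : Carrier) (R : RMDP n m) where

    -- x = sup_τ E_s^{σ,τ}
    WorstCaseCost : AgentPolicy n m → Fin n → Pred Carrier 0ℓ
    WorstCaseCost σ s = IsSup (λ y → ∃ λ τ → ExpectedCost γ R σ τ s y)

    -- x = inf_σ E_s^{σ,τ}
    BestCaseCost : AdversaryPolicy R → Fin n → Pred Carrier 0ℓ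
    BestCaseCost τ s = IsInf (λ y → ∃ λ σ → ExpectedCost γ R σ τ s y)

    IsValue : Pred (ℝ^ n) 0ℓ
    IsValue v = ∀ s → IsInf (λ y → ∃ λ σ → WorstCaseCost σ s y) (v s)

    IsOptimalAgent : Pred (AgentPolicy n m) 0ℓ
    IsOptimalAgent σ = ∃ λ v → IsValue v × (∀ s → WorstCaseCost σ s (v s))

    IsOptimalAdversary : Pred (AdversaryPolicy R) 0ℓ
    IsOptimalAdversary τ = ∃ λ v → IsValue v × (∀ s → BestCaseCost τ s (v s))

  record DiscRMCSolution {n} (γ : Carrier) (C : RMC n) : Set where
    field
      value             : ℝ^ n
      value-correct     : IsValue γ C value
      adversary         : AdversaryPolicy C
      adversary-optimal : IsOptimalAdversary γ C adversary

  -- The chain R^σ.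
  fixAgent : ∀ {n m} → RMDP n m → AgentPolicy n m → RMC n
  fixAgent R σ = record
    { cost       = cost
    ; Succ       = λ s _ → Succ s (σ s)
    ; 𝒫          = λ s _ → 𝒫 s (σ s)
    ; 𝒫-resp-≈   = λ s _ → 𝒫-resp-≈ s (σ s)
    ; 𝒫⊆Δ        = λ s _ → 𝒫⊆Δ s (σ s)
    ; 𝒫-nonempty = λ s _ → 𝒫-nonempty s (σ s)
    ; 𝒫-compact  = λ s _ → 𝒫-compact s (σ s)
    }
    where open RMDP R

  DiscRMCOracle : ∀ {n m} → Carrier → RMDP n m → Set
  DiscRMCOracle {n} {m} γ R = (σ : AgentPolicy n m) → DiscRMCSolution γ (fixAgent R σ)

  -- An arg min operator for each state. Ties are broken arbitrarily, but by a
  -- function of the minimised objective: if ties could be broken differently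
  -- each time, the iteration might switch between optimal policies forever.
  record ArgMin (n m : ℕ) : Set where
    field
      argmin         : Fin n → (Fin m → Carrier) → Fin m
      argmin-cong    : ∀ s {f g : Fin m → Carrier} → (∀ a → f a ≈ g a) →
                       argmin s f ≡ argmin s g
      argmin-minimal : ∀ s (f : Fin m → Carrier) a → f (argmin s f) ≤ f a

  module PolicyIteration {n m : ℕ} (γ : Carrier) (R : RMDP n m)
                         (oracle : DiscRMCOracle γ R) (selection : ArgMin n m) where
    open RMDP R
    open ArgMin selection

    -- One pass through the loop body, with one call of the oracle: from σ^{t-1}
    -- to σ^t.
    record Iteration (σ σ′ : AgentPolicy n m) : Set where
      P : Matrix n
      P = transition (λ _ → Fin.zero) (DiscRMCSolution.adversary (oracle σ))

      field
        inverse   : Matrix n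
        isInverse : IsInverse (resolvent γ P) inverse

      v : ℝ^ n
      v = inverse *ᵛ cost

      field
        Q      : Fin n → Fin m → Carrier
        Q-max  : ∀ s a →
                 IsMax (λ q → ∃ λ p → 𝒫 s a p × q ≈ cost s + γ * dot p v) (Q s a)
        update : ∀ s → σ′ s ≡ argmin s (Q s)

    -- Run σ k q σ* : started from σ, the algorithm returns σ* after k iterations
    -- and q calls of the oracle. An Iteration determines σ′ up to _≗_ (the value
    -- vector and the maxima are unique), so that k, q and, up to _≗_, σ* are
    -- determined by σ: all runs from σ agree.
    data Run (σ : AgentPolicy n m) : ℕ → ℕ → AgentPolicy n m → Set where
      stop     : ∀ {σ′} → Iteration σ σ′ → σ′ ≗ σ → Run σ 1 1 σ′
      continue : ∀ {σ′ σ* k q} → Iteration σ σ′ → ¬ (σ′ ≗ σ) →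
                 Run σ′ k q σ* → Run σ (suc k) (suc q) σ*

{-# OPTIONS --safe #-}
module Submission where

-- Write T_σ for the worst-case Bellman operator of the policy σ, and v_σ and v* for
-- the fixpoints of T_σ and of the optimality operator. These operators satisfy
-- Blackwell's conditions, so that x ≤ T x implies x ≤ v, and policy iteration gives
-- v_σₜ ≤ v* + γᵗ ‖v_σ₀ - v*‖. The advantage T_σ v* - v* at a state s depends on σ only
-- through σ s, and
--   T_σ v* - v* ≤ v_σ - v* ≤ max (T_σ v* - v*) / (1 - γ).
-- Hence, as soon as γᵗ < 1 - γ, the advantage of σₜ is below the maximal advantage of
-- a nonoptimal σ₀, attained at s₀ say, and the action σ₀ s₀ is never used at s₀ again.
-- If γᴸ < 1 - γ, each block of L iterations thus eliminates one of the n m pairs of a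
-- state and an action until the policy is optimal, and the next two iterations agree.
-- The least such L is at most 1 + log (1 - γ) / log γ.

open import Defs
open import Level using (0ℓ)
open import Axiom.ExcludedMiddle using (ExcludedMiddle)
open import Data.Fin.Base using (Fin; zero; suc; toℕ; combine)
import Data.Fin.Properties as Finₚ
open import Data.Fin.Subset using (Subset)
open import Data.List.Base using (allFin)
import Data.List.Extrema as Extrema
open import Data.List.Membership.Propositional.Properties using (∈-allFin)
import Data.List.Relation.Unary.All as All
open import Data.Nat.Base as ℕ using (ℕ; NonZero)
open import Data.Nat.GeneralisedArithmetic using (iterate)
import Data.Nat.Properties as ℕₚ
open import Data.Product.Base using (∃; _×_; _,_; proj₁; proj₂)
open import Data.Sum.Base using (inj₁; inj₂; [_,_]′)
open import Function.Base using (_∘_; case_of_; id)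
open import Relation.Binary.Bundles using (StrictTotalOrder; DecTotalOrder)
open import Relation.Binary.Definitions using (tri<; tri≈; tri>)
open import Relation.Binary.PropositionalEquality.Core as ≡ using (_≡_; _≗_)
open import Relation.Nullary.Decidable.Core using (yes; no)
open import Relation.Nullary.Negation.Core using (¬_; contradiction)
open import Relation.Unary using (Pred)

iterate-+ : ∀ {A : Set} (f : A → A) x m n → iterate f x (m ℕ.+ n) ≡ iterate f (iterate f x m) n
iterate-+ f x ℕ.zero    n = ≡.refl
iterate-+ f x (ℕ.suc m) n = iterate-+ f (f x) m n

-- Arithmetic in ordered fields.

module OrderedFieldProperties (F : OrderedField) where
  open OrderedField F hiding (zero)
  open StrictTotalOrder strictTotalOrder public
    using (irrefl; asym; <-respˡ-≈; <-respʳ-≈; strictPartialOrder)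
    renaming (trans to <-trans)
  open DecTotalOrder decTotalOrder public
    using ()
    renaming ( refl to ≤-refl; reflexive to ≤-reflexive; trans to ≤-trans
             ; antisym to ≤-antisym; total to ≤-total)
  open import Algebra.Properties.Ring ring public
    using (-‿distribʳ-*; -‿involutive; -0#≈0#; +-cancelʳ)
  open import Relation.Binary.Reasoning.StrictPartialOrder strictPartialOrder

  <⇒≤ : ∀ {x y} → x < y → x ≤ y
  <⇒≤ = inj₁

  ≮⇒≥ : ∀ {x y} → ¬ (x < y) → y ≤ x
  ≮⇒≥ {x} {y} x≮y with compare x y
  ... | tri< x<y _ _ = contradiction x<y x≮y
  ... | tri≈ _ x≈y _ = inj₂ (sym x≈y)
  ... | tri> _ _ y<x = inj₁ y<x

  <⇒≱ : ∀ {x y} → x < y → ¬ (y ≤ x)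
  <⇒≱ x<y (inj₁ y<x) = asym x<y y<x
  <⇒≱ x<y (inj₂ y≈x) = irrefl (sym y≈x) x<y

  +-monoˡ-< : ∀ x {y z} → y < z → y + x < z + x
  +-monoˡ-< x {y} {z} y<z = begin-strict
    y + x ≈⟨ +-comm y x ⟩
    x + y <⟨ +-monoʳ-< x y<z ⟩
    x + z ≈⟨ +-comm x z ⟩
    z + x ∎

  +-monoʳ-≤ : ∀ x {y z} → y ≤ z → x + y ≤ x + z
  +-monoʳ-≤ x (inj₁ y<z) = inj₁ (+-monoʳ-< x y<z)
  +-monoʳ-≤ x (inj₂ y≈z) = inj₂ (+-congˡ y≈z)

  +-monoˡ-≤ : ∀ x {y z} → y ≤ z → y + x ≤ z + x
  +-monoˡ-≤ x (inj₁ y<z) = inj₁ (+-monoˡ-< x y<z)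
  +-monoˡ-≤ x (inj₂ y≈z) = inj₂ (+-congʳ y≈z)

  +-mono-≤ : ∀ {x y z w} → x ≤ y → z ≤ w → x + z ≤ y + w
  +-mono-≤ {y = y} {z} x≤y z≤w = ≤-trans (+-monoˡ-≤ z x≤y) (+-monoʳ-≤ y z≤w)

  +-cancelˡ-≤ : ∀ x {y z} → x + y ≤ x + z → y ≤ z
  +-cancelˡ-≤ x x+y≤x+z = ≮⇒≥ λ z<y → <⇒≱ (+-monoʳ-< x z<y) x+y≤x+z

  +-cancelˡ-< : ∀ x {y z} → x + y < x + z → y < z
  +-cancelˡ-< x {y} {z} x+y<x+z with compare y z
  ... | tri< y<z _ _ = y<z
  ... | tri≈ _ y≈z _ = contradiction x+y<x+z (irrefl (+-congˡ y≈z))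
  ... | tri> _ _ z<y = contradiction x+y<x+z (asym (+-monoʳ-< x z<y))

  x≤x+y : ∀ {x y} → 0# ≤ y → x ≤ x + y
  x≤x+y {x} {y} 0≤y = begin
    x      ≈⟨ +-identityʳ x ⟨
    x + 0# ≤⟨ +-monoʳ-≤ x 0≤y ⟩
    x + y  ∎

  0≤x+y : ∀ {x y} → 0# ≤ x → 0# ≤ y → 0# ≤ x + y
  0≤x+y 0≤x 0≤y = ≤-trans 0≤x (x≤x+y 0≤y)

  x+[y-x]≈y : ∀ x y → x + (y - x) ≈ y
  x+[y-x]≈y x y = begin-equality
    x + (y - x)   ≈⟨ +-congˡ (+-comm y (- x)) ⟩
    x + (- x + y) ≈⟨ +-assoc x (- x) y ⟨
    x - x + y     ≈⟨ +-congʳ (-‿inverseʳ x) ⟩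
    0# + y        ≈⟨ +-identityˡ y ⟩
    y             ∎

  x-y+y≈x : ∀ x y → x - y + y ≈ x
  x-y+y≈x x y = trans (+-comm (x - y) y) (x+[y-x]≈y y x)

  x<y⇒0<y-x : ∀ {x y} → x < y → 0# < y - x
  x<y⇒0<y-x {x} {y} x<y = +-cancelˡ-< x (begin-strict
    x + 0#      ≈⟨ +-identityʳ x ⟩
    x           <⟨ x<y ⟩
    y           ≈⟨ x+[y-x]≈y x y ⟨
    x + (y - x) ∎)

  x-y≤z⇒x≤y+z : ∀ {x y z} → x - y ≤ z → x ≤ y + z
  x-y≤z⇒x≤y+z {x} {y} {z} x-y≤z = begin
    x           ≈⟨ x+[y-x]≈y y x ⟨
    y + (x - y) ≤⟨ +-monoʳ-≤ y x-y≤z ⟩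
    y + z       ∎

  0≤x+y⇒-y≤x : ∀ {x y} → 0# ≤ x + y → - y ≤ x
  0≤x+y⇒-y≤x {x} {y} 0≤x+y = +-cancelˡ-≤ y (begin
    y - y ≈⟨ -‿inverseʳ y ⟩
    0#    ≤⟨ 0≤x+y ⟩
    x + y ≈⟨ +-comm x y ⟩
    y + x ∎)

  *-monoʳ-< : ∀ {k x y} → 0# < k → x < y → k * x < k * y
  *-monoʳ-< {k} {x} {y} 0<k x<y = begin-strict
    k * x               ≈⟨ +-identityʳ (k * x) ⟨
    k * x + 0#          <⟨ +-monoʳ-< (k * x) (*-pos 0<k (x<y⇒0<y-x x<y)) ⟩
    k * x + k * (y - x) ≈⟨ distribˡ k x (y - x) ⟨
    k * (x + (y - x))   ≈⟨ *-congˡ (x+[y-x]≈y x y) ⟩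
    k * y               ∎

  *-monoˡ-< : ∀ {k x y} → 0# < k → x < y → x * k < y * k
  *-monoˡ-< {k} {x} {y} 0<k x<y =
    <-respˡ-≈ (*-comm k x) (<-respʳ-≈ (*-comm k y) (*-monoʳ-< 0<k x<y))

  *-monoʳ-≤ : ∀ {k x y} → 0# ≤ k → x ≤ y → k * x ≤ k * y
  *-monoʳ-≤ 0≤k        (inj₂ x≈y) = inj₂ (*-congˡ x≈y)
  *-monoʳ-≤ (inj₁ 0<k) (inj₁ x<y) = inj₁ (*-monoʳ-< 0<k x<y)
  *-monoʳ-≤ {k} {x} {y} (inj₂ 0≈k) (inj₁ _) = inj₂ (begin-equality
    k * x  ≈⟨ *-congʳ 0≈k ⟨
    0# * x ≈⟨ zeroˡ x ⟩
    0#     ≈⟨ zeroˡ y ⟨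
    0# * y ≈⟨ *-congʳ 0≈k ⟩
    k * y  ∎)

  *-monoˡ-≤ : ∀ {k x y} → 0# ≤ k → x ≤ y → x * k ≤ y * k
  *-monoˡ-≤ {k} {x} {y} 0≤k x≤y = begin
    x * k ≈⟨ *-comm x k ⟩
    k * x ≤⟨ *-monoʳ-≤ 0≤k x≤y ⟩
    k * y ≈⟨ *-comm k y ⟩
    y * k ∎

  -‿antitone-≤ : ∀ {x y} → x ≤ y → - y ≤ - x
  -‿antitone-≤ {x} {y} x≤y = 0≤x+y⇒-y≤x (begin
    0#      ≈⟨ -‿inverseˡ x ⟨
    - x + x ≤⟨ +-monoʳ-≤ (- x) x≤y ⟩
    - x + y ∎)

  x≤0⇒0≤-x : ∀ {x} → x ≤ 0# → 0# ≤ - x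
  x≤0⇒0≤-x x≤0 = ≤-trans (≤-reflexive (sym -0#≈0#)) (-‿antitone-≤ x≤0)

  *-monoˡ-≤-nonPos : ∀ {k x y} → k ≤ 0# → x ≤ y → y * k ≤ x * k
  *-monoˡ-≤-nonPos {k} {x} {y} k≤0 x≤y = begin
    y * k       ≈⟨ -‿involutive (y * k) ⟨
    - - (y * k) ≈⟨ -‿cong (-‿distribʳ-* y k) ⟩
    - (y * - k) ≤⟨ -‿antitone-≤ (*-monoˡ-≤ (x≤0⇒0≤-x k≤0) x≤y) ⟩
    - (x * - k) ≈⟨ -‿cong (-‿distribʳ-* x k) ⟨
    - - (x * k) ≈⟨ -‿involutive (x * k) ⟩
    x * k       ∎

  *-monoˡ-<-neg : ∀ {k x y} → k < 0# → x < y → y * k < x * k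
  *-monoˡ-<-neg {k} {x} {y} k<0 x<y = +-cancelˡ-< (x * - k) (begin-strict
    x * - k + y * k <⟨ +-monoˡ-< (y * k) (*-monoˡ-< 0<-k x<y) ⟩
    y * - k + y * k ≈⟨ cancels y ⟩
    0#              ≈⟨ cancels x ⟨
    x * - k + x * k ∎)
    where
    0<-k : 0# < - k
    0<-k = <-respʳ-≈ (+-identityˡ (- k)) (x<y⇒0<y-x k<0)
    cancels : ∀ z → z * - k + z * k ≈ 0#
    cancels z = begin-equality
      z * - k + z * k ≈⟨ distribˡ z (- k) k ⟨
      z * (- k + k)   ≈⟨ *-congˡ (-‿inverseˡ k) ⟩
      z * 0#          ≈⟨ zeroʳ z ⟩
      0#              ∎

  *-nonNeg : ∀ {x y} → 0# ≤ x → 0# ≤ y → 0# ≤ x * y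
  *-nonNeg {x} {y} 0≤x 0≤y = begin
    0#     ≈⟨ zeroʳ x ⟨
    x * 0# ≤⟨ *-monoʳ-≤ 0≤x 0≤y ⟩
    x * y  ∎

  *-<-identity : ∀ {k x} → k < 1# → 0# < x → k * x < x
  *-<-identity {x = x} k<1 0<x = <-respʳ-≈ (*-identityˡ x) (*-monoˡ-< 0<x k<1)

  >⇒≉ : ∀ {x y} → y < x → ¬ (x ≈ y)
  >⇒≉ y<x x≈y = irrefl (sym x≈y) y<x

  ⁻¹-pos : ∀ {x} → 0# < x → 0# < x ⁻¹
  ⁻¹-pos {x} 0<x with compare 0# (x ⁻¹)
  ... | tri< 0<x⁻¹ _ _ = 0<x⁻¹
  ... | tri≈ _ 0≈x⁻¹ _ = contradiction 0<1 (irrefl (begin-equality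
    0#       ≈⟨ zeroʳ x ⟨
    x * 0#   ≈⟨ *-congˡ 0≈x⁻¹ ⟩
    x * x ⁻¹ ≈⟨ ⁻¹-inverse x (>⇒≉ 0<x) ⟩
    1#       ∎))
  ... | tri> _ _ x⁻¹<0 = contradiction 0<1 (asym (begin-strict
    1#       ≈⟨ ⁻¹-inverse x (>⇒≉ 0<x) ⟨
    x * x ⁻¹ <⟨ *-monoʳ-< 0<x x⁻¹<0 ⟩
    x * 0#   ≈⟨ zeroʳ x ⟩
    0#       ∎))

  quotient : ∀ {k} → 0# < k → ∀ x → k * (k ⁻¹ * x) ≈ x
  quotient {k} 0<k x = begin-equality
    k * (k ⁻¹ * x) ≈⟨ *-assoc k (k ⁻¹) x ⟨
    k * k ⁻¹ * x   ≈⟨ *-congʳ (⁻¹-inverse k (>⇒≉ 0<k)) ⟩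
    1# * x         ≈⟨ *-identityˡ x ⟩
    x              ∎

  halve : ∀ {x} → 0# < x → ∃ λ y → 0# < y × y + y ≈ x
  halve {x} 0<x = 2⁻¹ * x , *-pos (⁻¹-pos 0<2) 0<x , (begin-equality
    2⁻¹ * x + 2⁻¹ * x               ≈⟨ +-cong (*-identityˡ _) (*-identityˡ _) ⟨
    1# * (2⁻¹ * x) + 1# * (2⁻¹ * x) ≈⟨ distribʳ (2⁻¹ * x) 1# 1# ⟨
    (1# + 1#) * (2⁻¹ * x)           ≈⟨ quotient 0<2 x ⟩
    x                               ∎)
    where
    2⁻¹ : Carrier
    2⁻¹ = (1# + 1#) ⁻¹
    0<2 : 0# < 1# + 1#
    0<2 = <-trans 0<1 (<-respˡ-≈ (+-identityʳ 1#) (+-monoʳ-< 1# 0<1))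

  fromℕ-nonNeg : ∀ k → 0# ≤ fromℕ k
  fromℕ-nonNeg ℕ.zero    = ≤-refl
  fromℕ-nonNeg (ℕ.suc k) = 0≤x+y (<⇒≤ 0<1) (fromℕ-nonNeg k)

  fromℕ-mono-≤ : ∀ {j k} → j ℕ.≤ k → fromℕ j ≤ fromℕ k
  fromℕ-mono-≤ {k = k} ℕ.z≤n = fromℕ-nonNeg k
  fromℕ-mono-≤ (ℕ.s≤s j≤k) = +-monoʳ-≤ 1# (fromℕ-mono-≤ j≤k)

  sum-mono-≤ : ∀ {n} {x y : Fin n → Carrier} → (∀ i → x i ≤ y i) → sum x ≤ sum y
  sum-mono-≤ {ℕ.zero}  x≤y = ≤-refl
  sum-mono-≤ {ℕ.suc n} x≤y = +-mono-≤ (x≤y zero) (sum-mono-≤ (x≤y ∘ suc))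

  sum-nonNeg : ∀ {n} {x : Fin n → Carrier} → (∀ i → 0# ≤ x i) → 0# ≤ sum x
  sum-nonNeg {ℕ.zero}  0≤x = ≤-refl
  sum-nonNeg {ℕ.suc n} 0≤x = 0≤x+y (0≤x zero) (sum-nonNeg (0≤x ∘ suc))

  maximum : ∀ {n} → Fin n → (f : Fin n → Carrier) → ∃ λ i → ∀ j → f j ≤ f i
  maximum {n} i f = argmax f i (allFin n) ,
    λ j → All.lookup (f[xs]≤f[argmax] {f = f} i (allFin n)) (∈-allFin j)
    where open Extrema totalOrder

  -- ∣ x i ∣ ≤ B, without absolute values.
  bounded : ∀ {n} (x : Fin n → Carrier) →
            ∃ λ B → 0# ≤ B × (∀ i → x i ≤ B) × (∀ i → 0# ≤ x i + B)
  bounded {ℕ.zero}  x = 0# , ≤-refl , (λ ()) , λ ()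
  bounded {ℕ.suc n} x with bounded (x ∘ suc)
  -- The bound built by the recursion is the sum of the absolute values of the entries.
  ... | B , 0≤B , x≤B , 0≤x+B with ≤-total 0# (x zero)
  ... | inj₁ 0≤x₀ = B + x zero , 0≤x+y 0≤B 0≤x₀ ,
    (λ { zero    → ≤-trans (x≤x+y 0≤B) (≤-reflexive (+-comm (x zero) B))
       ; (suc i) → ≤-trans (x≤B i) (x≤x+y 0≤x₀) }) ,
    (λ { zero    → 0≤x+y 0≤x₀ (0≤x+y 0≤B 0≤x₀)
       ; (suc i) → ≤-trans (0≤x+B i) (+-monoʳ-≤ (x (suc i)) (x≤x+y 0≤x₀)) })
  ... | inj₂ x₀≤0 = B - x zero , 0≤x+y 0≤B 0≤-x₀ ,
    (λ { zero    → ≤-trans x₀≤0 (0≤x+y 0≤B 0≤-x₀)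
       ; (suc i) → ≤-trans (x≤B i) (x≤x+y 0≤-x₀) }) ,
    (λ { zero    → ≤-trans 0≤B (≤-reflexive (sym (x+[y-x]≈y (x zero) B)))
       ; (suc i) → ≤-trans (0≤x+B i) (+-monoʳ-≤ (x (suc i)) (x≤x+y 0≤-x₀)) })
    where
    0≤-x₀ : 0# ≤ - x zero
    0≤-x₀ = x≤0⇒0≤-x x₀≤0

-- Limits, linear algebra and compactness over the reals.

module RealVectors (em : ExcludedMiddle 0ℓ) (ℝ : RealNumbers) where
  open RealNumbers ℝ hiding (zero)
  open OrderedFieldProperties orderedField public
  open import Algebra.Properties.Semiring.Sum semiring
    using (sum-cong-≋; ∑-distrib-+; ∑-comm; *-distribˡ-sum; *-distribʳ-sum)
  open import Algebra.Properties.CommutativeSemigroup *-commutativeSemigroup using (x∙yz≈y∙xz)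
  open import Relation.Binary.Reasoning.StrictPartialOrder strictPartialOrder

  infix 4 _≤ᵛ_
  _≤ᵛ_ : ∀ {n} → ℝ^ ℝ n → ℝ^ ℝ n → Set
  x ≤ᵛ y = ∀ i → x i ≤ y i

  limit-unique : ∀ {f x y} → ConvergesTo f x → ConvergesTo f y → x ≈ y
  limit-unique f→x f→y = ≤-antisym (≮⇒≥ (≮-limit f→x f→y)) (≮⇒≥ (≮-limit f→y f→x))
    where
    ≮-limit : ∀ {f x y} → ConvergesTo f x → ConvergesTo f y → ¬ (y < x)
    ≮-limit {f} {x} {y} f→x f→y y<x with halve (x<y⇒0<y-x y<x)
    ... | ε , 0<ε , ε+ε≈x-y with f→x ε 0<ε | f→y ε 0<ε
    ... | M , close-x | N , close-y = irrefl refl (begin-strict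
      x               <⟨ proj₂ (close-x (M ℕ.+ N) (ℕₚ.m≤m+n M N)) ⟩
      f (M ℕ.+ N) + ε <⟨ +-monoˡ-< ε (proj₁ (close-y (M ℕ.+ N) (ℕₚ.m≤n+m N M))) ⟩
      y + ε + ε       ≈⟨ +-assoc y ε ε ⟩
      y + (ε + ε)     ≈⟨ +-congˡ ε+ε≈x-y ⟩
      y + (x - y)     ≈⟨ x+[y-x]≈y y x ⟩
      x               ∎)

  module _ {n} {X : Subset n} {p : ℝ^ ℝ n} (p∈Δ : Δ ℝ X p) where
    open Δ p∈Δ

    dot-mono : ∀ {x y} → x ≤ᵛ y → dot ℝ p x ≤ dot ℝ p y
    dot-mono x≤y = sum-mono-≤ λ i → *-monoʳ-≤ (nonNegative i) (x≤y i)

    -- Because `p` has total mass one, constants pass through the expectation. This is the source of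
    -- the term `γ * k` in Blackwell's discounting condition.
    dot-shift : ∀ x k → dot ℝ p (λ i → x i + k) ≈ dot ℝ p x + k
    dot-shift x k = begin-equality
      sum (λ i → p i * (x i + k))     ≈⟨ sum-cong-≋ (λ i → distribˡ (p i) (x i) k) ⟩
      sum (λ i → p i * x i + p i * k) ≈⟨ ∑-distrib-+ (λ i → p i * x i) (λ i → p i * k) ⟩
      dot ℝ p x + sum (λ i → p i * k) ≈⟨ +-congˡ (*-distribʳ-sum k p) ⟨
      dot ℝ p x + sum p * k           ≈⟨ +-congˡ (*-congʳ total) ⟩
      dot ℝ p x + 1# * k              ≈⟨ +-congˡ (*-identityˡ k) ⟩
      dot ℝ p x + k                   ∎

  identity-suc : ∀ {n} (i j : Fin n) → identity ℝ (suc i) (suc j) ≈ identity ℝ i j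
  identity-suc i j with i Finₚ.≟ j
  ... | yes _ = refl
  ... | no  _ = refl

  identity-sym : ∀ {n} (i j : Fin n) → identity ℝ i j ≈ identity ℝ j i
  identity-sym i j with i Finₚ.≟ j | j Finₚ.≟ i
  ... | yes _   | yes _   = refl
  ... | no  _   | no  _   = refl
  ... | yes i≡j | no  j≢i = contradiction (≡.sym i≡j) j≢i
  ... | no  i≢j | yes j≡i = contradiction (≡.sym j≡i) i≢j

  identity-dot : ∀ {n} (i : Fin n) (x : ℝ^ ℝ n) → dot ℝ (identity ℝ i) x ≈ x i
  identity-dot {ℕ.suc n} zero x = begin-equality
    1# * x zero + sum (λ j → 0# * x (suc j))
      ≈⟨ +-cong (*-identityˡ (x zero)) (sym (*-distribˡ-sum 0# (x ∘ suc))) ⟩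
    x zero + 0# * sum (x ∘ suc)
      ≈⟨ +-congˡ (zeroˡ _) ⟩
    x zero + 0#
      ≈⟨ +-identityʳ (x zero) ⟩
    x zero ∎
  identity-dot (suc i) x = begin-equality
    0# * x zero + sum (λ j → identity ℝ (suc i) (suc j) * x (suc j))
      ≈⟨ +-cong (zeroˡ (x zero)) (sum-cong-≋ λ j → *-congʳ (identity-suc i j)) ⟩
    0# + dot ℝ (identity ℝ i) (x ∘ suc)
      ≈⟨ +-identityˡ _ ⟩
    dot ℝ (identity ℝ i) (x ∘ suc)
      ≈⟨ identity-dot i (x ∘ suc) ⟩
    x (suc i) ∎

  dot-identity : ∀ {n} (x : ℝ^ ℝ n) (k : Fin n) → dot ℝ x (λ j → identity ℝ j k) ≈ x k
  dot-identity x k = begin-equality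
    sum (λ j → x j * identity ℝ j k)
      ≈⟨ sum-cong-≋ (λ j → trans (*-comm (x j) _) (*-congʳ (identity-sym j k))) ⟩
    dot ℝ (identity ℝ k) x
      ≈⟨ identity-dot k x ⟩
    x k ∎

  dot-sum : ∀ {n k} (x : ℝ^ ℝ n) (y : Fin k → ℝ^ ℝ n) →
            dot ℝ x (λ j → sum (λ t → y t j)) ≈ sum (λ t → dot ℝ x (y t))
  dot-sum x y = begin-equality
    sum (λ j → x j * sum (λ t → y t j)) ≈⟨ sum-cong-≋ (λ j → *-distribˡ-sum (x j) (λ t → y t j)) ⟩
    sum (λ j → sum (λ t → x j * y t j)) ≈⟨ ∑-comm (λ j t → x j * y t j) ⟩
    sum (λ t → sum (λ j → x j * y t j)) ∎

  dot-scale : ∀ {n} k (x y : ℝ^ ℝ n) → dot ℝ x (λ i → k * y i) ≈ k * dot ℝ x y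
  dot-scale k x y = begin-equality
    sum (λ i → x i * (k * y i)) ≈⟨ sum-cong-≋ (λ i → x∙yz≈y∙xz (x i) k (y i)) ⟩
    sum (λ i → k * (x i * y i)) ≈⟨ *-distribˡ-sum k (λ i → x i * y i) ⟨
    k * dot ℝ x y               ∎

  right-inverse-solves : ∀ {n} {M N : Matrix ℝ n} →
    (∀ i → _≈ᵛ_ ℝ (_*ᴹ_ ℝ M N i) (identity ℝ i)) →
    ∀ b i → dot ℝ (M i) (_*ᵛ_ ℝ N b) ≈ b i
  right-inverse-solves {M = M} {N} MN≈I b i = begin-equality
    dot ℝ (M i) (_*ᵛ_ ℝ N b)
      ≈⟨ dot-sum (M i) (λ k j → N j k * b k) ⟩
    sum (λ k → sum (λ j → M i j * (N j k * b k)))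
      ≈⟨ sum-cong-≋ (λ k → sum-cong-≋ λ j → *-assoc (M i j) (N j k) (b k)) ⟨
    sum (λ k → sum (λ j → M i j * N j k * b k))
      ≈⟨ sum-cong-≋ (λ k → *-distribʳ-sum (b k) (λ j → M i j * N j k)) ⟨
    sum (λ k → _*ᴹ_ ℝ M N i k * b k)
      ≈⟨ sum-cong-≋ (λ k → *-congʳ (MN≈I i k)) ⟩
    dot ℝ (identity ℝ i) b
      ≈⟨ identity-dot i b ⟩
    b i ∎

  -- `w` is the absolute value of `v`. Each sign of `v` uses one of the two inequalities in `Close`.
  *-perturbation : ∀ v → ∃ λ w → 0# ≤ w × (∀ {x y ε} → Close ε x y → y * v ≤ x * v + ε * w)
  *-perturbation v with ≤-total 0# v
  ... | inj₁ 0≤v = v , 0≤v , λ {x} {y} {ε} close → begin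
    y * v         ≤⟨ *-monoˡ-≤ 0≤v (<⇒≤ (proj₂ close)) ⟩
    (x + ε) * v   ≈⟨ distribʳ v x ε ⟩
    x * v + ε * v ∎
  ... | inj₂ v≤0 = - v , x≤0⇒0≤-x v≤0 , λ {x} {y} {ε} close → begin
    y * v                   ≈⟨ x-y+y≈x (y * v) (ε * v) ⟨
    y * v - ε * v + ε * v   ≈⟨ +-comm _ _ ⟩
    ε * v + (y * v - ε * v) ≈⟨ +-assoc _ _ _ ⟨
    ε * v + y * v - ε * v   ≈⟨ +-congʳ (trans (+-comm _ _) (sym (distribʳ v y ε))) ⟩
    (y + ε) * v - ε * v     ≤⟨ +-monoˡ-≤ _ (*-monoˡ-≤-nonPos v≤0 (<⇒≤ (proj₁ close))) ⟩
    x * v - ε * v           ≈⟨ +-congˡ (-‿distribʳ-* ε v) ⟩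
    x * v + ε * - v         ∎

  -- `W` is the sum of the absolute values of `v`, a Lipschitz constant of the functional for the
  -- maximum norm.
  dot-perturbation : ∀ {n} (v : ℝ^ ℝ n) → ∃ λ W → 0# ≤ W ×
    (∀ {x y ε} → (∀ i → Close ε (x i) (y i)) → dot ℝ y v ≤ dot ℝ x v + ε * W)
  dot-perturbation v = sum w , sum-nonNeg (λ i → proj₁ (proj₂ (*-perturbation (v i)))) ,
    λ {x} {y} {ε} close → begin
      sum (λ i → y i * v i)
        ≤⟨ sum-mono-≤ (λ i → proj₂ (proj₂ (*-perturbation (v i))) (close i)) ⟩
      sum (λ i → x i * v i + ε * w i)
        ≈⟨ ∑-distrib-+ (λ i → x i * v i) (λ i → ε * w i) ⟩
      dot ℝ x v + sum (λ i → ε * w i)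
        ≈⟨ +-congˡ (*-distribˡ-sum ε w) ⟨
      dot ℝ x v + ε * sum w ∎
    where
    w : _
    w i = proj₁ (*-perturbation (v i))

  halfspace-open : ∀ {n} (v : ℝ^ ℝ n) b → Open ℝ (λ x → dot ℝ x v < b)
  halfspace-open v b x xv<b with dot-perturbation v
  ... | W , 0≤W , perturbed = ε , 0<ε , λ y close → begin-strict
    dot ℝ y v                   ≤⟨ perturbed close ⟩
    dot ℝ x v + ε * W           <⟨ +-monoʳ-< (dot ℝ x v) εW<d ⟩
    dot ℝ x v + (b - dot ℝ x v) ≈⟨ x+[y-x]≈y (dot ℝ x v) b ⟩
    b                           ∎
    where
    d ε : Carrier
    d = b - dot ℝ x v
    -- The divisor `W + 1#` is positive even if `W` vanishes, and it makes `ε * W` strictly smaller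
    -- than `d`.
    ε = (W + 1#) ⁻¹ * d
    0<W+1 : 0# < W + 1#
    0<W+1 = begin-strict
      0#     ≤⟨ 0≤W ⟩
      W      ≈⟨ +-identityʳ W ⟨
      W + 0# <⟨ +-monoʳ-< W 0<1 ⟩
      W + 1# ∎
    0<ε : 0# < ε
    0<ε = *-pos (⁻¹-pos 0<W+1) (x<y⇒0<y-x xv<b)
    εW<d : ε * W < d
    εW<d = begin-strict
      ε * W          ≈⟨ +-identityʳ (ε * W) ⟨
      ε * W + 0#     <⟨ +-monoʳ-< (ε * W) 0<ε ⟩
      ε * W + ε      ≈⟨ +-congˡ (*-identityʳ ε) ⟨
      ε * W + ε * 1# ≈⟨ distribˡ ε W 1# ⟨
      ε * (W + 1#)   ≈⟨ *-comm ε (W + 1#) ⟩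
      (W + 1#) * ε   ≈⟨ quotient 0<W+1 d ⟩
      d              ∎

  abstract
    -- If p · v has no maximum on K, the half-spaces { p ∣ p · v < q · v } with q
    -- in K cover K, and the largest q · v in a finite subcover is not covered.
    max-attained : ∀ {n} {K : Pred (ℝ^ ℝ n) 0ℓ} → Compact ℝ K → ∃ K → (v : ℝ^ ℝ n) →
                   ∃ λ p → K p × (∀ q → K q → dot ℝ q v ≤ dot ℝ p v)
    max-attained {K = K} K-compact point v
      with em {∃ λ p → K p × (∀ q → K q → dot ℝ q v ≤ dot ℝ p v)}
    ... | yes max = max
    ... | no ¬max with K-compact (∃ K) (λ q x → dot ℝ x v < dot ℝ (proj₁ q) v)
                         (λ q → halfspace-open v (dot ℝ (proj₁ q) v)) cover
      where
      cover : ∀ p → K p → ∃ λ (q : ∃ K) → dot ℝ p v < dot ℝ (proj₁ q) v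
      cover p p∈K with em {∃ λ (q : ∃ K) → dot ℝ p v < dot ℝ (proj₁ q) v}
      ... | yes covered = covered
      ... | no ¬covered = contradiction
        (p , p∈K , λ q q∈K → ≮⇒≥ λ pv<qv → ¬covered ((q , q∈K) , pv<qv)) ¬max
    ... | qs , subcover
      -- `point` is the default for an empty subcover. The points carry their membership in `K`, so
      -- `best` lies in `K` and must be covered.
      with All.lookupAny (f[xs]≤f[argmax] {f = λ q → dot ℝ (proj₁ q) v} point qs) (subcover (proj₁ best) (proj₂ best))
      where
      open Extrema totalOrder
      best : ∃ K
      best = argmax (λ q → dot ℝ (proj₁ q) v) point qs
    ... | q≤best , best<q = contradiction q≤best (<⇒≱ best<q)

-- Discounted operators and Markov chains.

record DiscountFactor (ℝ : RealNumbers) : Set where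
  open RealNumbers ℝ
  field
    γ   : Carrier
    0≤γ : 0# ≤ γ
    γ<1 : γ < 1#

module Discounting (em : ExcludedMiddle 0ℓ) (ℝ : RealNumbers) (d : DiscountFactor ℝ) where
  open RealNumbers ℝ hiding (zero)
  open DiscountFactor d
  open RealVectors em ℝ
  open import Algebra.Properties.Semiring.Sum semiring
    using (sum-cong-≋; ∑-distrib-+; *-distribˡ-sum)
  open import Relation.Binary.Reasoning.StrictPartialOrder strictPartialOrder

  0<1-γ : 0# < 1# - γ
  0<1-γ = x<y⇒0<y-x γ<1

  γx+[1-γ]x≈x : ∀ x → γ * x + (1# - γ) * x ≈ x
  γx+[1-γ]x≈x x = begin-equality
    γ * x + (1# - γ) * x ≈⟨ distribʳ x γ (1# - γ) ⟨
    (γ + (1# - γ)) * x   ≈⟨ *-congʳ (x+[y-x]≈y γ 1#) ⟩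
    1# * x               ≈⟨ *-identityˡ x ⟩
    x                    ∎

  ^-nonNeg : ∀ k → 0# ≤ γ ^ k
  ^-nonNeg ℕ.zero    = <⇒≤ 0<1
  ^-nonNeg (ℕ.suc k) = *-nonNeg 0≤γ (^-nonNeg k)

  ^-antitone : ∀ {j k} → j ℕ.≤ k → γ ^ k ≤ γ ^ j
  ^-antitone j≤k = antitone′ (ℕₚ.≤⇒≤′ j≤k)
    where
    antitone′ : ∀ {j k} → j ℕ.≤′ k → γ ^ k ≤ γ ^ j
    antitone′ (ℕ.≤′-reflexive ≡.refl) = ≤-refl
    antitone′ {j} {ℕ.suc k} (ℕ.≤′-step j≤k) = begin
      γ * γ ^ k  ≤⟨ *-monoˡ-≤ (^-nonNeg k) (<⇒≤ γ<1) ⟩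
      1# * γ ^ k ≈⟨ *-identityˡ (γ ^ k) ⟩
      γ ^ k      ≤⟨ antitone′ j≤k ⟩
      γ ^ j      ∎

  -- Otherwise the infimum g of γ ^ k * B is positive, and g + (1 - γ) g is
  -- still a lower bound.
  geometric-decay : ∀ {B ε} → 0# ≤ B → 0# < ε → ∃ λ k → γ ^ k * B < ε
  geometric-decay {B} {ε} 0≤B 0<ε with em {∃ λ k → γ ^ k * B < ε}
  ... | yes decays = decays
  ... | no  ¬decays
    -- Completeness is about suprema, so the infimum is taken as the supremum of the lower bounds:
    -- `ε` is one of them and `γ ^ 0 * B` bounds them above.
    with complete (λ x → ∀ k → x ≤ γ ^ k * B) (ε , λ k → ≮⇒≥ λ < → ¬decays (k , <))
                  (γ ^ 0 * B , λ _ x≤ → x≤ 0)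
  ... | g , upper , least = contradiction (upper (g + (1# - γ) * g) still-lower) (<⇒≱ (begin-strict
    g                ≈⟨ +-identityʳ g ⟨
    g + 0#           <⟨ +-monoʳ-< g (*-pos 0<1-γ 0<g) ⟩
    g + (1# - γ) * g ∎))
    where
    0<g : 0# < g
    0<g = begin-strict
      0# <⟨ 0<ε ⟩
      ε  ≤⟨ upper ε (λ k → ≮⇒≥ λ < → ¬decays (k , <)) ⟩
      g  ∎
    g≤ : ∀ k → g ≤ γ ^ k * B
    g≤ k = least (γ ^ k * B) λ _ x≤ → x≤ k
    still-lower : ∀ k → g + (1# - γ) * g ≤ γ ^ k * B
    still-lower k = begin
      g + (1# - γ) * g
        -- The first `g` is bounded by the next power and the second by the current one, so that the
        -- weights `γ` and `1# - γ` add up to one.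
        ≤⟨ +-mono-≤ (g≤ (ℕ.suc k)) (*-monoʳ-≤ (<⇒≤ 0<1-γ) (g≤ k)) ⟩
      γ * γ ^ k * B + (1# - γ) * (γ ^ k * B)
        ≈⟨ +-congʳ (*-assoc γ (γ ^ k) B) ⟩
      γ * (γ ^ k * B) + (1# - γ) * (γ ^ k * B)
        ≈⟨ γx+[1-γ]x≈x (γ ^ k * B) ⟩
      γ ^ k * B ∎

  geometric-limit : ∀ {B} → 0# ≤ B → ∀ {f x} →
    (∀ k → x ≤ f k + γ ^ k * B) → (∀ k → f k ≤ x + γ ^ k * B) → ConvergesTo f x
  geometric-limit {B} 0≤B {f} {x} x≤f f≤x ε 0<ε with geometric-decay 0≤B 0<ε
  ... | N , γᴺB<ε = N , λ k N≤k →
    (begin-strict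
      f k           ≤⟨ f≤x k ⟩
      x + γ ^ k * B <⟨ +-monoʳ-< x (small N≤k) ⟩
      x + ε         ∎) ,
    (begin-strict
      x               ≤⟨ x≤f k ⟩
      f k + γ ^ k * B <⟨ +-monoʳ-< (f k) (small N≤k) ⟩
      f k + ε         ∎)
    where
    small : ∀ {k} → N ℕ.≤ k → γ ^ k * B < ε
    small {k} N≤k = begin-strict
      γ ^ k * B ≤⟨ *-monoˡ-≤ 0≤B (^-antitone N≤k) ⟩
      γ ^ N * B <⟨ γᴺB<ε ⟩
      ε         ∎

  -- Blackwell's conditions for F to be a γ-contraction in the maximum norm.
  record Blackwell {n} (F : ℝ^ ℝ n → ℝ^ ℝ n) : Set where
    field
      mono     : ∀ x y → x ≤ᵛ y → F x ≤ᵛ F y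
      discount : ∀ x {k} → 0# ≤ k → ∀ i → F (λ j → x j + k) i ≤ F x i + γ * k

    mono-discount : ∀ x y {k} → 0# ≤ k → (∀ i → x i ≤ y i + k) → ∀ i → F x i ≤ F y i + γ * k
    mono-discount x y {k} 0≤k x≤y+k i =
      ≤-trans (mono x (λ j → y j + k) x≤y+k i) (discount y 0≤k i)

  -- The elimination argument uses only these two properties of the worst-case action values; the
  -- uncertainty sets themselves stay hidden from it.
  record ActionValues (n m : ℕ) : Set where
    field
      Q          : ℝ^ ℝ n → Fin n → Fin m → Carrier
      Q-mono     : ∀ x y → x ≤ᵛ y → ∀ s a → Q x s a ≤ Q y s a
      Q-discount : ∀ x k s a → Q (λ j → x j + k) s a ≤ Q x s a + γ * k

  module BlackwellProperties {n} {F : ℝ^ ℝ n → ℝ^ ℝ n} (F-blackwell : Blackwell F) where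
    open Blackwell F-blackwell

    -- A maximum principle. At an index where `x - y` is largest, a positive gap would survive one
    -- application of `F` only after shrinking by `γ`, and so would be smaller than itself.
    comparison : ∀ x y → x ≤ᵛ F x → F y ≤ᵛ y → x ≤ᵛ y
    comparison x y x≤Fx Fy≤y s with maximum s (λ j → x j - y j)
    ... | i , gap-max = ≤-trans (x-y≤z⇒x≤y+z (≤-trans (gap-max s) (≮⇒≥ gap≯0))) (≤-reflexive (+-identityʳ (y s)))
      where
      gap : Carrier
      gap = x i - y i
      gap≯0 : ¬ (0# < gap)
      gap≯0 0<gap = irrefl refl (begin-strict
        x i             ≤⟨ x≤Fx i ⟩
        F x i           ≤⟨ mono-discount x y (<⇒≤ 0<gap) (λ j → x-y≤z⇒x≤y+z (gap-max j)) i ⟩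
        F y i + γ * gap ≤⟨ +-monoˡ-≤ (γ * gap) (Fy≤y i) ⟩
        y i + γ * gap   <⟨ +-monoʳ-< (y i) (*-<-identity γ<1 0<gap) ⟩
        y i + gap       ≈⟨ x+[y-x]≈y (y i) (x i) ⟩
        x i             ∎)

    fixpoint-unique : ∀ x y → (∀ i → x i ≈ F x i) → (∀ i → y i ≈ F y i) → ∀ i → x i ≈ y i
    fixpoint-unique x y x≈Fx y≈Fy i = ≤-antisym
      (comparison x y (≤-reflexive ∘ x≈Fx) (≤-reflexive ∘ sym ∘ y≈Fy) i)
      (comparison y x (≤-reflexive ∘ y≈Fy) (≤-reflexive ∘ sym ∘ x≈Fx) i)

    abstract
      -- Knaster-Tarski: the fixpoint is the supremum of all x ≤ F x.
      fixpoint : ∃ λ x → ∀ i → x i ≈ F x i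
      fixpoint with bounded (F (λ _ → 0#))
      ... | A , 0≤A , F0≤A , 0≤F0+A =
        -- From `x ≤ F x` and monotonicity, `F x` is itself a postfixpoint and hence lies below the
        -- supremum `x`.
        x , λ i → ≤-antisym (x≤Fx i) (below-x (F x) (mono x (F x) x≤Fx) i)
        where
        M : Carrier
        -- `M` solves `γ * M + A = M`. The constant `- M` is then a postfixpoint and the constant
        -- `M` a prefixpoint, so the set is nonempty and, by `comparison`, bounded above.
        M = (1# - γ) ⁻¹ * A
        0≤M : 0# ≤ M
        0≤M = *-nonNeg (<⇒≤ (⁻¹-pos 0<1-γ)) 0≤A
        γM+A≈M : γ * M + A ≈ M
        γM+A≈M = trans (+-congˡ (sym (quotient 0<1-γ A))) (γx+[1-γ]x≈x M)

        PostFixpoint : ℝ^ ℝ n → Set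
        PostFixpoint y = y ≤ᵛ F y

        -M-post : PostFixpoint (λ _ → - M)
        -M-post i = 0≤x+y⇒-y≤x (begin
          0#
            ≤⟨ 0≤F0+A i ⟩
          F (λ _ → 0#) i + A
            ≤⟨ +-monoˡ-≤ A (mono-discount (λ _ → 0#) (λ _ → - M) 0≤M (λ _ → ≤-reflexive (sym (-‿inverseˡ M))) i) ⟩
          F (λ _ → - M) i + γ * M + A
            ≈⟨ +-assoc _ _ _ ⟩
          F (λ _ → - M) i + (γ * M + A)
            ≈⟨ +-congˡ γM+A≈M ⟩
          F (λ _ → - M) i + M ∎)

        M-pre : F (λ _ → M) ≤ᵛ (λ _ → M)
        M-pre i = begin
          F (λ _ → M) i
            ≤⟨ mono-discount (λ _ → M) (λ _ → 0#) 0≤M (λ _ → ≤-reflexive (sym (+-identityˡ M))) i ⟩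
          F (λ _ → 0#) i + γ * M
            ≤⟨ +-monoˡ-≤ (γ * M) (F0≤A i) ⟩
          A + γ * M
            ≈⟨ +-comm A (γ * M) ⟩
          γ * M + A
            ≈⟨ γM+A≈M ⟩
          M ∎

        post-sup : ∀ i → ∃ (IsSup (λ z → ∃ λ y → PostFixpoint y × z ≈ y i))
        post-sup i = complete _ (- M , (λ _ → - M) , -M-post , refl)
          (M , λ z (y , y≤Fy , z≈y) → ≤-trans (≤-reflexive z≈y) (comparison y (λ _ → M) y≤Fy M-pre i))
        x : ℝ^ ℝ n
        x i = proj₁ (post-sup i)
        below-x : ∀ y → PostFixpoint y → y ≤ᵛ x
        below-x y y≤Fy i = proj₁ (proj₂ (post-sup i)) (y i) (y , y≤Fy , refl)
        x≤Fx : x ≤ᵛ F x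
        x≤Fx i = proj₂ (proj₂ (post-sup i)) (F x i) λ z (y , y≤Fy , z≈y) → begin
          z     ≈⟨ z≈y ⟩
          y i   ≤⟨ y≤Fy i ⟩
          F y i ≤⟨ mono y x (below-x y y≤Fy) i ⟩
          F x i ∎

  module _ {n} {X : Fin n → Subset n} {P : Matrix ℝ n} (P-stochastic : ∀ i → Δ ℝ (X i) (P i)) where

    -- The evaluation operator of a Markov chain with stage costs `b`. Its fixpoints are the
    -- solutions of the linear system with matrix `resolvent ℝ γ P`.
    affine : ℝ^ ℝ n → ℝ^ ℝ n → ℝ^ ℝ n
    affine b x i = b i + γ * dot ℝ (P i) x

    affine-blackwell : ∀ b → Blackwell (affine b)
    affine-blackwell b = record
      { mono     = λ x y x≤y i →
          +-monoʳ-≤ (b i) (*-monoʳ-≤ 0≤γ (dot-mono (P-stochastic i) x≤y))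
      ; discount = λ x {k} 0≤k i → ≤-reflexive (begin-equality
          b i + γ * dot ℝ (P i) (λ j → x j + k) ≈⟨ +-congˡ (*-congˡ (dot-shift (P-stochastic i) x k)) ⟩
          b i + γ * (dot ℝ (P i) x + k)         ≈⟨ +-congˡ (distribˡ γ _ k) ⟩
          b i + (γ * dot ℝ (P i) x + γ * k)     ≈⟨ +-assoc _ _ _ ⟨
          b i + γ * dot ℝ (P i) x + γ * k       ∎)
      }

    resolvent-split : ∀ x i → dot ℝ (resolvent ℝ γ P i) x + γ * dot ℝ (P i) x ≈ x i
    resolvent-split x i = begin-equality
      dot ℝ (resolvent ℝ γ P i) x + γ * dot ℝ (P i) x
        ≈⟨ +-congˡ (*-distribˡ-sum γ (λ j → P i j * x j)) ⟩
      dot ℝ (resolvent ℝ γ P i) x + sum (λ j → γ * (P i j * x j))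
        ≈⟨ ∑-distrib-+ (λ j → resolvent ℝ γ P i j * x j) (λ j → γ * (P i j * x j)) ⟨
      sum (λ j → resolvent ℝ γ P i j * x j + γ * (P i j * x j))
        ≈⟨ sum-cong-≋ (λ j → begin-equality
          (identity ℝ i j - γ * P i j) * x j + γ * (P i j * x j) ≈⟨ +-congˡ (*-assoc γ (P i j) (x j)) ⟨
          (identity ℝ i j - γ * P i j) * x j + γ * P i j * x j   ≈⟨ distribʳ (x j) _ _ ⟨
          (identity ℝ i j - γ * P i j + γ * P i j) * x j         ≈⟨ *-congʳ (x-y+y≈x _ _) ⟩
          identity ℝ i j * x j                                   ∎) ⟩
      dot ℝ (identity ℝ i) x
        ≈⟨ identity-dot i x ⟩
      x i ∎

    fixpoint⇒solution : ∀ {b x} → (∀ i → x i ≈ affine b x i) →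
                        ∀ i → dot ℝ (resolvent ℝ γ P i) x ≈ b i
    fixpoint⇒solution {b} {x} x-fix i = +-cancelʳ _ _ _ (begin-equality
      dot ℝ (resolvent ℝ γ P i) x + γ * dot ℝ (P i) x ≈⟨ resolvent-split x i ⟩
      x i                                             ≈⟨ x-fix i ⟩
      b i + γ * dot ℝ (P i) x                         ∎)

    solution⇒fixpoint : ∀ {b x} → (∀ i → dot ℝ (resolvent ℝ γ P i) x ≈ b i) →
                        ∀ i → x i ≈ affine b x i
    solution⇒fixpoint {b} {x} x-sol i = begin-equality
      x i                                             ≈⟨ resolvent-split x i ⟨
      dot ℝ (resolvent ℝ γ P i) x + γ * dot ℝ (P i) x ≈⟨ +-congʳ (x-sol i) ⟩
      b i + γ * dot ℝ (P i) x                         ∎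

    abstract
      -- The columns of `N` solve the system for the unit vectors, which makes `N` a right inverse.
      -- It is also a left inverse: column `k` of the product `N *ᴹ resolvent` and the unit vector
      -- `k` both solve the system whose right-hand side is column `k` of the resolvent, and
      -- solutions are unique.
      resolvent-invertible : ∃ (IsInverse ℝ (resolvent ℝ γ P))
      resolvent-invertible = N , right , λ i k → left k i
        where
        solution : ∀ k → ∃ λ x → ∀ i → x i ≈ affine (λ j → identity ℝ j k) x i
        solution k = BlackwellProperties.fixpoint (affine-blackwell (λ j → identity ℝ j k))
        N : Matrix ℝ n
        N i k = proj₁ (solution k) i
        right : ∀ i → _≈ᵛ_ ℝ (_*ᴹ_ ℝ (resolvent ℝ γ P) N i) (identity ℝ i)
        right i k = fixpoint⇒solution (proj₂ (solution k)) i
        left : ∀ k i → dot ℝ (N i) (λ j → resolvent ℝ γ P j k) ≈ identity ℝ i k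
        left k = BlackwellProperties.fixpoint-unique
          (affine-blackwell (λ j → resolvent ℝ γ P j k)) _ _
          (solution⇒fixpoint (right-inverse-solves right _))
          (solution⇒fixpoint λ i → dot-identity (resolvent ℝ γ P i) k)

    -- This unfolds to the sequence whose limit defines `ExpectedCost`.
    partialCost : ℝ^ ℝ n → ℕ → ℝ^ ℝ n
    partialCost c N s = sum {N} λ t → γ ^ toℕ t * expectedCostAt ℝ P c (toℕ t) s

    -- Splitting off the cost at time 0 leaves a discounted run that starts one transition later.
    -- The partial costs are thus the iterates of `affine c` from the zero vector.
    partialCost-suc : ∀ c N s → partialCost c (ℕ.suc N) s ≈ affine c (partialCost c N) s
    partialCost-suc c N s = +-cong (*-identityˡ (c s)) (begin-equality
      sum (λ t → γ * γ ^ toℕ t * dot ℝ (P s) (e t))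
        ≈⟨ sum-cong-≋ (λ t → *-assoc γ (γ ^ toℕ t) (dot ℝ (P s) (e t))) ⟩
      sum (λ t → γ * (γ ^ toℕ t * dot ℝ (P s) (e t)))
        ≈⟨ *-distribˡ-sum γ (λ t → γ ^ toℕ t * dot ℝ (P s) (e t)) ⟨
      γ * sum (λ t → γ ^ toℕ t * dot ℝ (P s) (e t))
        ≈⟨ *-congˡ (sum-cong-≋ λ t → dot-scale (γ ^ toℕ t) (P s) (e t)) ⟨
      γ * sum (λ t → dot ℝ (P s) (λ j → γ ^ toℕ t * e t j))
        ≈⟨ *-congˡ (dot-sum (P s) (λ t j → γ ^ toℕ t * e t j)) ⟨
      γ * dot ℝ (P s) (partialCost c N) ∎)
      where
      e : Fin N → ℝ^ ℝ n
      e t = expectedCostAt ℝ P c (toℕ t)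

    -- The zero vector is within `B` of the fixpoint, and each further period multiplies the error
    -- by `γ`.
    partialCost-converges : ∀ {c v} → (∀ s → v s ≈ affine c v s) →
                            ∀ s → ConvergesTo (λ N → partialCost c N s) (v s)
    partialCost-converges {c} {v} v-fix with bounded v
    ... | B , 0≤B , v≤B , 0≤v+B = λ s → geometric-limit 0≤B (λ k → lower k s) (λ k → upper k s)
      where
      open Blackwell (affine-blackwell c)
      0≤γᵏB : ∀ k → 0# ≤ γ ^ k * B
      0≤γᵏB k = *-nonNeg (^-nonNeg k) 0≤B
      lower : ∀ k s → v s ≤ partialCost c k s + γ ^ k * B
      lower ℕ.zero s = begin
        v s         ≤⟨ v≤B s ⟩
        B           ≈⟨ *-identityˡ B ⟨
        1# * B      ≈⟨ +-identityˡ (1# * B) ⟨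
        0# + 1# * B ∎
      lower (ℕ.suc k) s = begin
        v s
          ≈⟨ v-fix s ⟩
        affine c v s
          ≤⟨ mono-discount v (partialCost c k) (0≤γᵏB k) (lower k) s ⟩
        affine c (partialCost c k) s + γ * (γ ^ k * B)
          ≈⟨ +-cong (partialCost-suc c k s) (*-assoc γ (γ ^ k) B) ⟨
        partialCost c (ℕ.suc k) s + γ * γ ^ k * B ∎
      upper : ∀ k s → partialCost c k s ≤ v s + γ ^ k * B
      upper ℕ.zero s = ≤-trans (0≤v+B s) (≤-reflexive (+-congˡ (sym (*-identityˡ B))))
      upper (ℕ.suc k) s = begin
        partialCost c (ℕ.suc k) s      ≈⟨ partialCost-suc c k s ⟩
        affine c (partialCost c k) s   ≤⟨ mono-discount (partialCost c k) v (0≤γᵏB k) (upper k) s ⟩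
        affine c v s + γ * (γ ^ k * B) ≈⟨ +-cong (v-fix s) (*-assoc γ (γ ^ k) B) ⟨
        v s + γ * γ ^ k * B            ∎

-- Policy operators and their fixpoints.

module ActionValueProperties (em : ExcludedMiddle 0ℓ) (ℝ : RealNumbers) (d : DiscountFactor ℝ)
                             {n m : ℕ} (actionValues : Discounting.ActionValues em ℝ d n m) where
  open RealNumbers ℝ hiding (zero)
  open DiscountFactor d
  open RealVectors em ℝ
  open Discounting em ℝ d
  open ActionValues actionValues

  Q-cong : ∀ {x y} → (∀ i → x i ≈ y i) → ∀ s a → Q x s a ≈ Q y s a
  Q-cong {x} {y} x≈y s a = ≤-antisym (Q-mono x y (≤-reflexive ∘ x≈y) s a)
                                     (Q-mono y x (≤-reflexive ∘ sym ∘ x≈y) s a)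

  policyOperator : AgentPolicy ℝ n m → ℝ^ ℝ n → ℝ^ ℝ n
  policyOperator σ x s = Q x s (σ s)

  policyOperator-blackwell : ∀ σ → Blackwell (policyOperator σ)
  policyOperator-blackwell σ = record
    { mono     = λ x y x≤y s → Q-mono x y x≤y s (σ s)
    ; discount = λ x {k} _ s → Q-discount x k s (σ s)
    }

  module Policy (σ : AgentPolicy ℝ n m) where
    open Blackwell (policyOperator-blackwell σ) public
    open BlackwellProperties (policyOperator-blackwell σ) public

  -- The value of a policy is treated as a fixpoint throughout; `policyValue-worstCase` links it to
  -- suprema of expected costs.
  IsPolicyValue : AgentPolicy ℝ n m → Pred (ℝ^ ℝ n) 0ℓ
  IsPolicyValue σ v = ∀ s → v s ≈ Q v s (σ s)

  bellman≤policyValue : ∀ {v ρ w} → (∀ s a → v s ≤ Q v s a) → IsPolicyValue ρ w → v ≤ᵛ w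
  bellman≤policyValue {v} {ρ} {w} v≤Q w-fix =
    Policy.comparison ρ v w (λ s → v≤Q s (ρ s)) (≤-reflexive ∘ sym ∘ w-fix)

-- Robust action values, worst-case costs and the Bellman equation.

module RobustMDP (em : ExcludedMiddle 0ℓ) (ℝ : RealNumbers) (d : DiscountFactor ℝ)
                 {n m : ℕ} (R : RMDP ℝ n m) where
  open RealNumbers ℝ hiding (zero)
  open DiscountFactor d
  open RMDP R
  open RealVectors em ℝ
  open Discounting em ℝ d
  open import Relation.Binary.Reasoning.StrictPartialOrder strictPartialOrder

  worst : ∀ x s a → ∃ λ p → 𝒫 s a p × (∀ q → 𝒫 s a q → dot ℝ q x ≤ dot ℝ p x)
  worst x s a = max-attained (𝒫-compact s a) (𝒫-nonempty s a) x

  Q : ℝ^ ℝ n → Fin n → Fin m → Carrier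
  Q x s a = cost s + γ * dot ℝ (proj₁ (worst x s a)) x

  Q-upper : ∀ x s a {p} → 𝒫 s a p → cost s + γ * dot ℝ p x ≤ Q x s a
  Q-upper x s a p∈𝒫 = +-monoʳ-≤ (cost s) (*-monoʳ-≤ 0≤γ (proj₂ (proj₂ (worst x s a)) _ p∈𝒫))

  Q-isMax : ∀ x s a → IsMax (λ q → ∃ λ p → 𝒫 s a p × q ≈ cost s + γ * dot ℝ p x) (Q x s a)
  Q-isMax x s a = (proj₁ (worst x s a) , proj₁ (proj₂ (worst x s a)) , refl) ,
    λ y (p , p∈𝒫 , y≈) → ≤-trans (≤-reflexive y≈) (Q-upper x s a p∈𝒫)

  Q-mono : ∀ x y → x ≤ᵛ y → ∀ s a → Q x s a ≤ Q y s a
  Q-mono x y x≤y s a with worst x s a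
  ... | p , p∈𝒫 , _ = ≤-trans
    (+-monoʳ-≤ (cost s) (*-monoʳ-≤ 0≤γ (dot-mono (𝒫⊆Δ s a p p∈𝒫) x≤y)))
    (Q-upper y s a p∈𝒫)

  Q-discount : ∀ x k s a → Q (λ j → x j + k) s a ≤ Q x s a + γ * k
  Q-discount x k s a with worst (λ j → x j + k) s a
  ... | p , p∈𝒫 , _ = begin
    cost s + γ * dot ℝ p (λ j → x j + k) ≈⟨ +-congˡ (*-congˡ (dot-shift (𝒫⊆Δ s a p p∈𝒫) x k)) ⟩
    cost s + γ * (dot ℝ p x + k)         ≈⟨ +-congˡ (distribˡ γ _ k) ⟩
    cost s + (γ * dot ℝ p x + γ * k)     ≈⟨ +-assoc _ _ _ ⟨
    cost s + γ * dot ℝ p x + γ * k       ≤⟨ +-monoˡ-≤ (γ * k) (Q-upper x s a p∈𝒫) ⟩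
    Q x s a + γ * k                      ∎

  actionValues : ActionValues n m
  actionValues = record { Q = Q; Q-mono = Q-mono; Q-discount = Q-discount }

  open ActionValueProperties em ℝ d actionValues public

  transition-stochastic : ∀ σ (τ : AdversaryPolicy ℝ R) s → Δ ℝ (Succ s (σ s)) (transition ℝ σ τ s)
  transition-stochastic σ τ s = 𝒫⊆Δ s (σ s) _ (AdversaryPolicy.allowed τ s (σ s))

  IsCostVector : AgentPolicy ℝ n m → AdversaryPolicy ℝ R → Pred (ℝ^ ℝ n) 0ℓ
  IsCostVector σ τ w = ∀ s → w s ≈ affine (transition-stochastic σ τ) cost w s

  expectedCost : ∀ {σ τ w} → IsCostVector σ τ w → ∀ s → ExpectedCost ℝ γ R σ τ s (w s)
  expectedCost {σ} {τ} = partialCost-converges (transition-stochastic σ τ)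

  costVector : ∀ σ τ → ∃ (IsCostVector σ τ)
  costVector σ τ = BlackwellProperties.fixpoint (affine-blackwell (transition-stochastic σ τ) cost)

  worstAdversary : ℝ^ ℝ n → AdversaryPolicy ℝ R
  worstAdversary x = record
    { choice  = λ s a → proj₁ (worst x s a)
    ; allowed = λ s a → proj₁ (proj₂ (worst x s a))
    }

  -- The cost vector of any adversary is a subsolution for the operator of `σ`, hence at most `v`.
  -- The supremum is attained: with the maximisers at `v` as adversary, the fixpoint equation for
  -- `v` is literally the equation of a cost vector.
  policyValue-worstCase : ∀ {σ v} → IsPolicyValue σ v → ∀ s → WorstCaseCost ℝ γ R σ s (v s)
  policyValue-worstCase {σ} {v} v-fix s = upper ,
    λ u u-upper → u-upper (v s) (worstAdversary v , expectedCost {σ} {worstAdversary v} v-fix s)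
    where
    upper : ∀ y → (∃ λ τ → ExpectedCost ℝ γ R σ τ s y) → y ≤ v s
    upper y (τ , y-cost) = let w , w-fix = costVector σ τ in begin
      y   ≈⟨ limit-unique y-cost (expectedCost {σ} {τ} w-fix s) ⟩
      w s ≤⟨ Policy.comparison σ w v
               (λ i → ≤-trans (≤-reflexive (w-fix i)) (Q-upper w i (σ i) (AdversaryPolicy.allowed τ i (σ i))))
               (≤-reflexive ∘ sym ∘ v-fix) s ⟩
      v s ∎

  worstCase-policyValue : ∀ {σ v y s} → IsPolicyValue σ v → WorstCaseCost ℝ γ R σ s y → y ≈ v s
  worstCase-policyValue {v = v} {s = s} v-fix (y-upper , y-least) with policyValue-worstCase v-fix s
  ... | v-upper , v-least = ≤-antisym (y-least (v s) v-upper) (v-least _ y-upper)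

  -- The optimality equation, with `σ` as a witness that the minimum over the actions is attained.
  IsBellman : AgentPolicy ℝ n m → Pred (ℝ^ ℝ n) 0ℓ
  IsBellman σ v = IsPolicyValue σ v × (∀ s a → v s ≤ Q v s a)

  -- `v` is a subsolution for every policy operator, so it lies below every worst-case cost, and `σ`
  -- attains it.
  bellman-value : ∀ {σ v} → IsBellman σ v → IsValue ℝ γ R v
  bellman-value {σ} {v} (v-fix , v≤Q) s = lower ,
    λ l l-lower → l-lower (v s) (σ , policyValue-worstCase v-fix s)
    where
    lower : ∀ y → (∃ λ ρ → WorstCaseCost ℝ γ R ρ s y) → v s ≤ y
    lower y (ρ , y-worst) = let w , w-fix = Policy.fixpoint ρ in begin
      v s ≤⟨ bellman≤policyValue v≤Q w-fix s ⟩
      w s ≈⟨ worstCase-policyValue w-fix y-worst ⟨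
      y   ∎

  bellman-optimalAgent : ∀ {σ v} → IsBellman σ v → IsOptimalAgent ℝ γ R σ
  bellman-optimalAgent bellman = _ , bellman-value bellman , policyValue-worstCase (proj₁ bellman)

  value-unique : ∀ {v w} → IsValue ℝ γ R v → IsValue ℝ γ R w → ∀ s → v s ≈ w s
  value-unique v-value w-value s = ≤-antisym
    (proj₂ (w-value s) _ (proj₁ (v-value s)))
    (proj₂ (v-value s) _ (proj₁ (w-value s)))

-- Robust Markov chains and the oracle's adversary.

module RobustMC (em : ExcludedMiddle 0ℓ) (ℝ : RealNumbers) (d : DiscountFactor ℝ)
                {n : ℕ} (C : RMC ℝ n) where
  open RealNumbers ℝ hiding (zero)
  open DiscountFactor d
  open RealVectors em ℝ
  open Discounting em ℝ d
  open RobustMDP em ℝ d C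
  open import Relation.Binary.Reasoning.StrictPartialOrder strictPartialOrder

  only : AgentPolicy ℝ n 1
  only _ = zero

  -- In a chain the best case against `τ` is just the cost of `τ`. Optimality therefore equates `w`
  -- with the value of the chain, which is the fixpoint of the robust operator, although `w` was
  -- defined by the single matrix of `τ`.
  optimalAdversary-policyValue : ∀ {τ w} → IsOptimalAdversary ℝ γ C τ →
                                 IsCostVector only τ w → IsPolicyValue only w
  optimalAdversary-policyValue {τ} {w} (v , v-value , v-best) w-fix s with Policy.fixpoint only
  ... | u , u-fix = begin-equality
    w s        ≈⟨ w≈u s ⟩
    u s        ≈⟨ u-fix s ⟩
    Q u s zero ≈⟨ Q-cong w≈u s zero ⟨
    Q w s zero ∎
    where
    -- The infimum ranges over all functions into `Fin 1`, which agree with `only` pointwise.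
    agent-irrelevant : ∀ σ → IsCostVector σ τ w
    agent-irrelevant σ s with σ s
    ... | zero = w-fix s
    v≈w : ∀ s → v s ≈ w s
    v≈w s = ≤-antisym
      (proj₁ (v-best s) (w s) (only , expectedCost {only} {τ} w-fix s))
      (proj₂ (v-best s) (w s) λ y (σ , y-cost) →
        ≤-reflexive (limit-unique (expectedCost {σ} {τ} (agent-irrelevant σ) s) y-cost))
    w≈u : ∀ s → w s ≈ u s
    w≈u s = trans (sym (v≈w s))
      (value-unique v-value (bellman-value (u-fix , λ { s zero → ≤-reflexive (u-fix s) })) s)

  evaluation : ∀ {τ} → IsOptimalAdversary ℝ γ C τ →
    ∃ λ N → IsInverse ℝ (resolvent ℝ γ (transition ℝ only τ)) N ×
            IsPolicyValue only (_*ᵛ_ ℝ N (RMDP.cost C))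
  evaluation {τ} τ-optimal =
    let N , N-inverse = resolvent-invertible (transition-stochastic only τ)
    in N , N-inverse , optimalAdversary-policyValue {τ} τ-optimal
         (solution⇒fixpoint (transition-stochastic only τ)
           (right-inverse-solves (proj₁ N-inverse) (RMDP.cost C)))

-- Policy improvement, contraction and elimination of actions.

module PolicyImprovement
  (em : ExcludedMiddle 0ℓ) (ℝ : RealNumbers) (d : DiscountFactor ℝ)
  {n m : ℕ} (actionValues : Discounting.ActionValues em ℝ d n m) (selection : ArgMin ℝ n m)
  (v : AgentPolicy ℝ n m → ℝ^ ℝ n)
  (v-policyValue : ∀ σ → ActionValueProperties.IsPolicyValue em ℝ d actionValues σ (v σ)) where

  open RealNumbers ℝ hiding (zero)
  open DiscountFactor d
  open RealVectors em ℝ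
  open ArgMin selection
  open Discounting em ℝ d
  open ActionValues actionValues
  open ActionValueProperties em ℝ d actionValues
  open import Algebra.Properties.CommutativeSemigroup *-commutativeSemigroup using (x∙yz≈yx∙z)
  open import Relation.Binary.Reasoning.StrictPartialOrder strictPartialOrder

  greedy : ℝ^ ℝ n → AgentPolicy ℝ n m
  greedy x s = argmin s (Q x s)

  next : AgentPolicy ℝ n m → AgentPolicy ℝ n m
  next σ = greedy (v σ)

  -- The minimum over actions is the value at the greedy action. Replacing the greedy action of the
  -- left-hand vector by that of the right-hand one only increases the value and reduces both
  -- conditions to a fixed action.
  bellmanOperator-blackwell : Blackwell (λ x s → Q x s (greedy x s))
  bellmanOperator-blackwell = record
    { mono     = λ x y x≤y s → ≤-trans (argmin-minimal s (Q x s) (greedy y s))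
                                       (Q-mono x y x≤y s (greedy y s))
    ; discount = λ x {k} _ s → ≤-trans (argmin-minimal s (Q (λ j → x j + k) s) (greedy x s))
                                       (Q-discount x k s (greedy x s))
    }

  abstract
    bellmanFixpoint : ∃ λ x → IsPolicyValue (greedy x) x × (∀ s a → x s ≤ Q x s a)
    bellmanFixpoint with BlackwellProperties.fixpoint bellmanOperator-blackwell
    ... | x , x-fix = x , x-fix , λ s a →
      ≤-trans (≤-reflexive (x-fix s)) (argmin-minimal s (Q x s) a)

  v* : ℝ^ ℝ n
  v* = proj₁ bellmanFixpoint

  v*-policyValue : IsPolicyValue (greedy v*) v*
  v*-policyValue = proj₁ (proj₂ bellmanFixpoint)

  v*≤Q : ∀ s a → v* s ≤ Q v* s a
  v*≤Q = proj₂ (proj₂ bellmanFixpoint)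

  v*≤v : ∀ σ → v* ≤ᵛ v σ
  v*≤v σ = bellman≤policyValue v*≤Q (v-policyValue σ)

  Optimal : Pred (AgentPolicy ℝ n m) 0ℓ
  Optimal σ = v σ ≤ᵛ v*

  -- One policy iteration step is at least as good as one value iteration step: `v σ` is a
  -- supersolution for the improved policy, and applying that policy's operator to
  -- `v (next σ) ≤ v σ` yields the minimum over the actions.
  v-next≤Q : ∀ σ s a → v (next σ) s ≤ Q (v σ) s a
  v-next≤Q σ s a = begin
    v (next σ) s                ≈⟨ v-policyValue (next σ) s ⟩
    Q (v (next σ)) s (next σ s) ≤⟨ Q-mono (v (next σ)) (v σ) improves s (next σ s) ⟩
    Q (v σ) s (next σ s)        ≤⟨ argmin-minimal s (Q (v σ) s) a ⟩
    Q (v σ) s a                 ∎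
    where
    improves : v (next σ) ≤ᵛ v σ
    improves = Policy.comparison (next σ) (v (next σ)) (v σ)
      (≤-reflexive ∘ v-policyValue (next σ))
      (λ s → ≤-trans (argmin-minimal s (Q (v σ) s) (σ s)) (≤-reflexive (sym (v-policyValue σ s))))

  v-next≤v : ∀ σ → v (next σ) ≤ᵛ v σ
  v-next≤v σ s = ≤-trans (v-next≤Q σ s (σ s)) (≤-reflexive (sym (v-policyValue σ s)))

  -- Choosing the optimal action `greedy v* s` in `v-next≤Q` compares the step with the fixpoint
  -- equation of `v*`.
  v-next-contracts : ∀ σ {k} → 0# ≤ k → (∀ s → v σ s ≤ v* s + k) → ∀ s → v (next σ) s ≤ v* s + γ * k
  v-next-contracts σ {k} 0≤k vσ≤v*+k s = begin
    v (next σ) s                 ≤⟨ v-next≤Q σ s (greedy v* s) ⟩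
    Q (v σ) s (greedy v* s)      ≤⟨ Policy.mono-discount (greedy v*) (v σ) v* 0≤k vσ≤v*+k s ⟩
    Q v* s (greedy v* s) + γ * k ≈⟨ +-congʳ (v*-policyValue s) ⟨
    v* s + γ * k                 ∎

  v-iterate-contracts : ∀ t σ {k} → 0# ≤ k → (∀ s → v σ s ≤ v* s + k) →
                        ∀ s → v (iterate next σ t) s ≤ v* s + γ ^ t * k
  v-iterate-contracts ℕ.zero σ {k} 0≤k vσ≤v*+k s =
    ≤-trans (vσ≤v*+k s) (≤-reflexive (+-congˡ (sym (*-identityˡ k))))
  v-iterate-contracts (ℕ.suc t) σ {k} 0≤k vσ≤v*+k s = begin
    v (iterate next (next σ) t) s
      ≤⟨ v-iterate-contracts t (next σ) (*-nonNeg 0≤γ 0≤k) (v-next-contracts σ 0≤k vσ≤v*+k) s ⟩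
    v* s + γ ^ t * (γ * k)
      ≈⟨ +-congˡ (x∙yz≈yx∙z (γ ^ t) γ k) ⟩
    v* s + γ * γ ^ t * k ∎

  -- With A the largest advantage Q v* s (σ s) - v* s, attained at s₀, and
  -- (1 - γ) B = A, the later values are at most v* + γ ^ t * B. A policy that
  -- still plays σ s₀ at s₀ has value at least v* + A there.
  action-elimination : ∀ σ → ¬ Optimal σ → ∃ λ s → ∀ t → γ ^ t < 1# - γ → ¬ (iterate next σ t s ≡ σ s)
  action-elimination σ ¬optimal
    with Finₚ.¬∀⟶∃¬ n _ (λ s → v σ s ≤? v* s) ¬optimal
  -- `s₁` supplies the maximisation with a starting index.
  ... | s₁ , _ with maximum s₁ (λ s → Q v* s (σ s) - v* s)
  ... | s₀ , A-max = s₀ , eliminated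
    where
    A B : Carrier
    A = Q v* s₀ (σ s₀) - v* s₀
    B = (1# - γ) ⁻¹ * A
    Q≤v*+A : ∀ s → Q v* s (σ s) ≤ v* s + A
    Q≤v*+A s = x-y≤z⇒x≤y+z (A-max s)
    A≤0⇒optimal : A ≤ 0# → Optimal σ
    A≤0⇒optimal A≤0 = Policy.comparison σ (v σ) v* (≤-reflexive ∘ v-policyValue σ) λ s → begin
      Q v* s (σ s) ≤⟨ Q≤v*+A s ⟩
      v* s + A     ≤⟨ +-monoʳ-≤ (v* s) A≤0 ⟩
      v* s + 0#    ≈⟨ +-identityʳ (v* s) ⟩
      v* s         ∎
    0<A : 0# < A
    0<A with compare 0# A
    ... | tri< 0<A _ _ = 0<A
    ... | tri≈ _ 0≈A _ = contradiction (A≤0⇒optimal (≤-reflexive (sym 0≈A))) ¬optimal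
    ... | tri> _ _ A<0 = contradiction (A≤0⇒optimal (<⇒≤ A<0)) ¬optimal
    0<B : 0# < B
    0<B = *-pos (⁻¹-pos 0<1-γ) 0<A
    vσ≤v*+B : ∀ s → v σ s ≤ v* s + B
    -- `v* + B` is a supersolution for the operator of `σ`, because `A + γ * B = B`.
    vσ≤v*+B = Policy.comparison σ (v σ) (λ s → v* s + B) (≤-reflexive ∘ v-policyValue σ) λ s → begin
      Q (λ j → v* j + B) s (σ s)
        ≤⟨ Q-discount v* B s (σ s) ⟩
      Q v* s (σ s) + γ * B
        ≤⟨ +-monoˡ-≤ (γ * B) (Q≤v*+A s) ⟩
      v* s + A + γ * B
        ≈⟨ +-assoc (v* s) A (γ * B) ⟩
      v* s + (A + γ * B)
        ≈⟨ +-congˡ (trans (+-comm A (γ * B)) (+-congˡ (sym (quotient 0<1-γ A)))) ⟩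
      v* s + (γ * B + (1# - γ) * B)
        ≈⟨ +-congˡ (γx+[1-γ]x≈x B) ⟩
      v* s + B ∎
    eliminated : ∀ t → γ ^ t < 1# - γ → ¬ (iterate next σ t s₀ ≡ σ s₀)
    eliminated t γᵗ<1-γ ρs≡σs = irrefl refl (begin-strict
      v* s₀ + γ ^ t * B    <⟨ +-monoʳ-< (v* s₀) (*-monoˡ-< 0<B γᵗ<1-γ) ⟩
      v* s₀ + (1# - γ) * B ≈⟨ +-congˡ (quotient 0<1-γ A) ⟩
      v* s₀ + A            ≈⟨ x+[y-x]≈y (v* s₀) (Q v* s₀ (σ s₀)) ⟩
      Q v* s₀ (σ s₀)       ≡⟨ ≡.cong (Q v* s₀) ρs≡σs ⟨
      Q v* s₀ (ρ s₀)       ≤⟨ Q-mono v* (v ρ) (v*≤v ρ) s₀ (ρ s₀) ⟩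
      Q (v ρ) s₀ (ρ s₀)    ≈⟨ v-policyValue ρ s₀ ⟨
      v ρ s₀               ≤⟨ v-iterate-contracts t σ (<⇒≤ 0<B) vσ≤v*+B s₀ ⟩
      v* s₀ + γ ^ t * B    ∎)
      where
      ρ : AgentPolicy ℝ n m
      ρ = iterate next σ t

  -- Pigeonhole on the `n * m + 1` policies that start the blocks. If none were optimal, each would
  -- yield a pair of a state and an action that no later block start uses, yet two of these pairs
  -- must coincide.
  optimal-within : ∀ L → γ ^ L < 1# - γ → ∀ σ →
                   ∃ λ j → j ℕ.≤ n ℕ.* m × Optimal (iterate next σ (j ℕ.* L))
  optimal-within L γᴸ<1-γ σ with em {∃ λ (j : Fin (ℕ.suc (n ℕ.* m))) → Optimal (iterate next σ (toℕ j ℕ.* L))}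
  ... | yes (j , optimal) = toℕ j , ℕₚ.≤-pred (Finₚ.toℕ<n j) , optimal
  ... | no ¬optimal = contradiction repetition λ where
      (i , j , i<j , same) →
        let sᵢ≡sⱼ , aᵢ≡aⱼ = Finₚ.combine-injective (state i) (action i) (state j) (action j) same
            t = (toℕ j ℕ.∸ toℕ i) ℕ.* L
            later : iterate next (σ[ i ]) t ≡ σ[ j ]
            later = ≡.trans (≡.sym (iterate-+ next σ (toℕ i ℕ.* L) t))
                            (≡.cong (iterate next σ) (blocks (ℕₚ.<⇒≤ i<j)))
        in proj₂ (elimination i) t (γᵗ<1-γ i<j)
             (≡.trans (≡.cong-app later (state i))
             (≡.trans (≡.cong σ[ j ] sᵢ≡sⱼ) (≡.sym aᵢ≡aⱼ)))
    where
    σ[_] : Fin (ℕ.suc (n ℕ.* m)) → AgentPolicy ℝ n m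
    σ[ j ] = iterate next σ (toℕ j ℕ.* L)
    elimination : ∀ j → ∃ λ s → ∀ t → γ ^ t < 1# - γ → ¬ (iterate next σ[ j ] t s ≡ σ[ j ] s)
    elimination j = action-elimination σ[ j ] λ optimal → ¬optimal (j , optimal)
    state : Fin (ℕ.suc (n ℕ.* m)) → Fin n
    state j = proj₁ (elimination j)
    action : Fin (ℕ.suc (n ℕ.* m)) → Fin m
    action j = σ[ j ] (state j)
    repetition = Finₚ.pigeonhole (ℕₚ.n<1+n (n ℕ.* m)) λ j → combine (state j) (action j)
    blocks : ∀ {i j} → i ℕ.≤ j → i ℕ.* L ℕ.+ (j ℕ.∸ i) ℕ.* L ≡ j ℕ.* L
    blocks {i} {j} i≤j = ≡.trans (≡.sym (ℕₚ.*-distribʳ-+ L i (j ℕ.∸ i)))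
                                 (≡.cong (ℕ._* L) (ℕₚ.m+[n∸m]≡n i≤j))
    -- Distinct block starts are at least one full block apart, so the exponent is at least `L`.
    γᵗ<1-γ : ∀ {i j} → i ℕ.< j → γ ^ ((j ℕ.∸ i) ℕ.* L) < 1# - γ
    γᵗ<1-γ {i} {j} i<j = begin-strict
      γ ^ ((j ℕ.∸ i) ℕ.* L) ≤⟨ ^-antitone (ℕₚ.m≤n*m L (j ℕ.∸ i)) ⟩
      γ ^ L                 <⟨ γᴸ<1-γ ⟩
      1# - γ                ∎
      where
      instance
        j∸i-nonZero : NonZero (j ℕ.∸ i)
        j∸i-nonZero = ℕ.>-nonZero (ℕₚ.m<n⇒0<n∸m i<j)

  -- `σ` and `next σ` have the same value, so both greedy steps minimise equal objectives and
  -- `argmin-cong` breaks ties alike. An optimal `σ` may still differ from `next σ`, which costs one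
  -- more iteration.
  optimal⇒next-stable : ∀ {σ} → Optimal σ → next (next σ) ≗ next σ
  optimal⇒next-stable {σ} optimal s = argmin-cong s (Q-cong v-next≈v s)
    where
    v-next≈v : ∀ i → v (next σ) i ≈ v σ i
    v-next≈v i = ≤-antisym (v-next≤v σ i) (≤-trans (optimal i) (v*≤v (next σ) i))

-- Runs of the algorithm: correctness and termination.

module PolicyIterationAnalysis
  (em : ExcludedMiddle 0ℓ) (ℝ : RealNumbers) (d : DiscountFactor ℝ) {n m : ℕ} (R : RMDP ℝ n m)
  (oracle : DiscRMCOracle ℝ (DiscountFactor.γ d) R) (selection : ArgMin ℝ n m) where

  open RealNumbers ℝ hiding (zero)
  open DiscountFactor d
  open ArgMin selection
  open PolicyIteration ℝ γ R oracle selection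
  open RealVectors em ℝ
  open RobustMDP em ℝ d R

  abstract
    evaluate : ∀ σ →
      ∃ λ N → IsInverse ℝ (resolvent ℝ γ (transition ℝ (λ _ → zero) (DiscRMCSolution.adversary (oracle σ)))) N ×
              IsPolicyValue σ (_*ᵛ_ ℝ N (RMDP.cost R))
    -- The single action of `fixAgent` at `s` carries the set `𝒫 s (σ s)`, so the robust operator of
    -- the chain unfolds to that of `σ`.
    evaluate σ = RobustMC.evaluation em ℝ d (fixAgent ℝ R σ)
                   {DiscRMCSolution.adversary (oracle σ)} (DiscRMCSolution.adversary-optimal (oracle σ))

  v : AgentPolicy ℝ n m → ℝ^ ℝ n
  v σ = _*ᵛ_ ℝ (proj₁ (evaluate σ)) (RMDP.cost R)

  v-policyValue : ∀ σ → IsPolicyValue σ (v σ)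
  v-policyValue σ = proj₂ (proj₂ (evaluate σ))

  open PolicyImprovement em ℝ d actionValues selection v v-policyValue

  iteration : ∀ σ → Iteration σ (next σ)
  iteration σ = record
    { inverse   = proj₁ (evaluate σ)
    ; isInverse = proj₁ (proj₂ (evaluate σ))
    ; Q         = Q (v σ)
    ; Q-max     = Q-isMax (v σ)
    ; update    = λ _ → ≡.refl
    }

  -- If the greedy policy repeats `σ`, then `v σ` is a fixpoint whose actions minimise its own
  -- action values, which is the Bellman equation.
  stable-optimal : ∀ {σ} → next σ ≗ σ → IsOptimalAgent ℝ γ R (next σ)
  stable-optimal {σ} stable = bellman-optimalAgent {v = v σ} (next-value , λ s a →
      ≤-trans (≤-reflexive (next-value s)) (argmin-minimal s (Q (v σ) s) a))
    where
    next-value : IsPolicyValue (next σ) (v σ)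
    next-value s = trans (v-policyValue σ s) (reflexive (≡.cong (Q (v σ) s) (≡.sym (stable s))))

  Terminates : AgentPolicy ℝ n m → ℕ → Set
  Terminates σ bound = ∃ λ k → k ℕ.≤ bound × (∃ λ σ* → Run σ k k σ* × IsOptimalAgent ℝ γ R σ*)

  stable-terminates : ∀ {σ} → next σ ≗ σ → ∀ bound → Terminates σ (ℕ.suc bound)
  stable-terminates {σ} stable bound =
    1 , ℕ.s≤s ℕ.z≤n , next σ , stop (iteration σ) stable , stable-optimal stable

  -- The run from `σ` either prepends one iteration to the given run or stops at once, in which case
  -- stability gives optimality.
  terminates-suc : ∀ {σ bound} → Terminates (next σ) bound → Terminates σ (ℕ.suc bound)
  terminates-suc {σ} {bound} (k , k≤bound , σ* , run , optimal) = case em {next σ ≗ σ} of λ where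
    (yes stable) → stable-terminates stable bound
    (no ¬stable) → ℕ.suc k , ℕ.s≤s k≤bound , σ* , continue (iteration σ) ¬stable run , optimal

  -- After `T` iterations the policy is optimal. One further iteration makes it greedy for `v*`, and
  -- a last one observes that nothing changes.
  optimal-terminates : ∀ T σ → Optimal (iterate next σ T) → Terminates σ (T ℕ.+ 2)
  optimal-terminates ℕ.zero    σ optimal = terminates-suc (stable-terminates (optimal⇒next-stable optimal) 0)
  optimal-terminates (ℕ.suc T) σ optimal = terminates-suc (optimal-terminates T (next σ) optimal)

  termination : ∀ L → γ ^ L < 1# - γ → ∀ σ → Terminates σ (n ℕ.* m ℕ.* L ℕ.+ 2)
  termination L γᴸ<1-γ σ =
    let j , j≤nm , optimal = optimal-within L γᴸ<1-γ σ
        k , k≤ , result = optimal-terminates (j ℕ.* L) σ optimal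
    in k , ℕₚ.≤-trans k≤ (ℕₚ.+-monoˡ-≤ 2 (ℕₚ.*-monoˡ-≤ L j≤nm)) , result

-- The block length in terms of logarithms.

module HorizonBound (em : ExcludedMiddle 0ℓ) (ℝ : RealNumbers) (L : Logarithm ℝ)
                    (d : DiscountFactor ℝ) where
  open RealNumbers ℝ hiding (zero)
  open DiscountFactor d
  open Logarithm L
  open RealVectors em ℝ
  open Discounting em ℝ d
  open import Relation.Binary.Reasoning.StrictPartialOrder strictPartialOrder
  open import Algebra.Construct.NaturalChoice.Max totalOrder using (x≤x⊔y; x≤y⊔x)
  open import Algebra.Properties.CommutativeSemigroup *-commutativeSemigroup using (x∙yz≈yx∙z)
  open import Algebra.Properties.Semiring.Mult semiring using (×1-homo-*; ×-homo-+)

  log-mono-≤ : ∀ {x y} → 0# < x → x ≤ y → log x ≤ log y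
  log-mono-≤ 0<x (inj₁ x<y) = inj₁ (log-mono-< 0<x x<y)
  log-mono-≤ 0<x (inj₂ x≈y) = inj₂ (log-cong 0<x x≈y)

  log-1 : log 1# ≈ 0#
  log-1 = +-cancelʳ (log 1#) (log 1#) 0# (begin-equality
    log 1# + log 1# ≈⟨ log-* 0<1 0<1 ⟨
    log (1# * 1#)   ≈⟨ log-cong (<-respʳ-≈ (sym (*-identityˡ 1#)) 0<1) (*-identityˡ 1#) ⟩
    log 1#          ≈⟨ +-identityˡ (log 1#) ⟨
    0# + log 1#     ∎)

  module _ (0<γ : 0# < γ) where
    ^-pos : ∀ k → 0# < γ ^ k
    ^-pos ℕ.zero    = 0<1
    ^-pos (ℕ.suc k) = *-pos 0<γ (^-pos k)

    log-^ : ∀ k → log (γ ^ k) ≈ fromℕ k * log γ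
    log-^ ℕ.zero    = trans log-1 (sym (zeroˡ (log γ)))
    log-^ (ℕ.suc k) = begin-equality
      log (γ * γ ^ k)              ≈⟨ log-* 0<γ (^-pos k) ⟩
      log γ + log (γ ^ k)          ≈⟨ +-cong (sym (*-identityˡ (log γ))) (log-^ k) ⟩
      1# * log γ + fromℕ k * log γ ≈⟨ distribʳ (log γ) 1# (fromℕ k) ⟨
      (1# + fromℕ k) * log γ       ∎

    log-γ<0 : log γ < 0#
    log-γ<0 = <-respʳ-≈ log-1 (log-mono-< 0<γ γ<1)

    -- Taking logarithms turns the hypothesis into a linear inequality in `k`; dividing by the
    -- negative number `log γ` reverses it.
    exponent≤logRatio : ∀ k → 1# - γ ≤ γ ^ k → fromℕ k ≤ log (1# - γ) / log γ
    exponent≤logRatio k 1-γ≤γᵏ = ≮⇒≥ λ r<k → <⇒≱ (*-monoˡ-<-neg log-γ<0 r<k) (begin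
      r * log γ
        ≈⟨ *-assoc _ _ _ ⟩
      log (1# - γ) * (log γ ⁻¹ * log γ)
        ≈⟨ *-congˡ (trans (*-comm _ _) (⁻¹-inverse (log γ) (λ log-γ≈0 → irrefl log-γ≈0 log-γ<0))) ⟩
      log (1# - γ) * 1#
        ≈⟨ *-identityʳ _ ⟩
      log (1# - γ)
        ≤⟨ log-mono-≤ 0<1-γ 1-γ≤γᵏ ⟩
      log (γ ^ k)
        ≈⟨ log-^ k ⟩
      fromℕ k * log γ ∎)
      where
      r : Carrier
      r = log (1# - γ) / log γ

  -- A downward search from `k` meets a place where `P` switches, since `P` fails at 0.
  threshold : ∀ {P : Pred ℕ 0ℓ} → ¬ P 0 → ∀ {k} → P k → ∃ λ ℓ → ¬ P ℓ × P (ℕ.suc ℓ)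
  threshold ¬P0 {ℕ.zero}  P0  = contradiction P0 ¬P0
  threshold {P} ¬P0 {ℕ.suc k} Psk with em {P k}
  ... | yes Pk = threshold ¬P0 Pk
  ... | no ¬Pk = k , ¬Pk , Psk

  -- The exponent 0 is covered by the 1 in the maximum. For positive exponents the hypothesis
  -- excludes `γ = 0`, and the logarithmic bound applies.
  exponent≤1⊔logRatio : ∀ k → 1# - γ ≤ γ ^ k → fromℕ k ≤ 1# ⊔ logRatio γ
  exponent≤1⊔logRatio ℕ.zero    _ = ≤-trans (<⇒≤ 0<1) (x≤x⊔y 1# (logRatio γ))
  exponent≤1⊔logRatio (ℕ.suc k) 1-γ≤γᵏ⁺¹ with γ ≟ 0#
  ... | yes γ≈0 = contradiction 1-γ≤γᵏ⁺¹ (<⇒≱ (begin-strict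
    γ * γ ^ k  ≈⟨ *-congʳ γ≈0 ⟩
    0# * γ ^ k ≈⟨ zeroˡ (γ ^ k) ⟩
    0#         <⟨ 0<1-γ ⟩
    1# - γ     ∎))
  ... | no γ≉0 = ≤-trans (exponent≤logRatio 0<γ (ℕ.suc k) 1-γ≤γᵏ⁺¹) (x≤y⊔x 1# _)
    where
    0<γ : 0# < γ
    0<γ = [ id , (λ 0≈γ → contradiction (sym 0≈γ) γ≉0) ]′ 0≤γ

  -- The block length is `ℕ.suc ℓ`, where the powers of `γ` cross `1# - γ`: the exponent `ℕ.suc ℓ`
  -- is large enough for elimination, and `ℓ` is still small enough for the logarithmic bound.
  horizon : ∃ λ ℓ → γ ^ ℕ.suc ℓ < 1# - γ × fromℕ ℓ ≤ 1# ⊔ logRatio γ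
  horizon with geometric-decay (<⇒≤ 0<1) 0<1-γ
  ... | k , γᵏ*1<1-γ with threshold {λ j → γ ^ j < 1# - γ} 1≮1-γ {k} (<-respˡ-≈ (*-identityʳ (γ ^ k)) γᵏ*1<1-γ)
    where
    1≮1-γ : ¬ (1# < 1# - γ)
    1≮1-γ 1<1-γ = irrefl refl (begin-strict
      1#         <⟨ 1<1-γ ⟩
      1# - γ     ≤⟨ x≤x+y 0≤γ ⟩
      1# - γ + γ ≈⟨ x-y+y≈x 1# γ ⟩
      1#         ∎)
  ... | ℓ , γˡ≮1-γ , γˡ⁺¹<1-γ = ℓ , γˡ⁺¹<1-γ , exponent≤1⊔logRatio ℓ (≮⇒≥ γˡ≮1-γ)

  -- As `n * m` is at least 1, the two extra iterations are absorbed into `n * m * 2`, leaving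
  -- `n * m * (3 + ℓ)`. Both `1` and `ℓ` are at most the maximum, whence the constant 4.
  iterationBound : ∀ n m .{{_ : NonZero n}} .{{_ : NonZero m}} {k ℓ} →
    k ℕ.≤ n ℕ.* m ℕ.* ℕ.suc ℓ ℕ.+ 2 → fromℕ ℓ ≤ 1# ⊔ logRatio γ →
    fromℕ k ≤ fromℕ 4 * fromℕ n * fromℕ m * (1# ⊔ logRatio γ)
  iterationBound n m {k} {ℓ} k≤ ℓ≤M = begin
    fromℕ k
      ≤⟨ fromℕ-mono-≤ k≤nm[3+ℓ] ⟩
    fromℕ (n ℕ.* m ℕ.* (3 ℕ.+ ℓ))
      ≈⟨ trans (×1-homo-* (n ℕ.* m) (3 ℕ.+ ℓ)) (*-congˡ (×-homo-+ 1# 3 ℓ)) ⟩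
    fromℕ (n ℕ.* m) * (fromℕ 3 + fromℕ ℓ)
      ≤⟨ *-monoʳ-≤ (fromℕ-nonNeg (n ℕ.* m)) (+-mono-≤ 3≤3M ℓ≤M) ⟩
    fromℕ (n ℕ.* m) * (fromℕ 3 * M + M)
      ≈⟨ *-cong (×1-homo-* n m) 3M+M≈4M ⟩
    fromℕ n * fromℕ m * (fromℕ 4 * M)
      ≈⟨ x∙yz≈yx∙z _ _ _ ⟩
    fromℕ 4 * (fromℕ n * fromℕ m) * M
      ≈⟨ *-congʳ (*-assoc (fromℕ 4) (fromℕ n) (fromℕ m)) ⟨
    fromℕ 4 * fromℕ n * fromℕ m * M ∎
    where
    M : Carrier
    M = 1# ⊔ logRatio γ
    k≤nm[3+ℓ] : k ℕ.≤ n ℕ.* m ℕ.* (3 ℕ.+ ℓ)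
    k≤nm[3+ℓ] = ℕₚ.≤-trans k≤ (ℕₚ.≤-trans
      (ℕₚ.+-monoʳ-≤ (n ℕ.* m ℕ.* ℕ.suc ℓ) (ℕₚ.m≤n*m 2 (n ℕ.* m) {{ℕₚ.m*n≢0 n m}}))
      (ℕₚ.≤-reflexive (≡.trans (≡.sym (ℕₚ.*-distribˡ-+ (n ℕ.* m) (ℕ.suc ℓ) 2))
                               (≡.cong (n ℕ.* m ℕ.*_) (ℕₚ.+-comm (ℕ.suc ℓ) 2)))))
    3≤3M : fromℕ 3 ≤ fromℕ 3 * M
    3≤3M = begin
      fromℕ 3      ≈⟨ *-identityʳ (fromℕ 3) ⟨
      fromℕ 3 * 1# ≤⟨ *-monoʳ-≤ (fromℕ-nonNeg 3) (x≤x⊔y 1# (logRatio γ)) ⟩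
      fromℕ 3 * M  ∎
    3M+M≈4M : fromℕ 3 * M + M ≈ fromℕ 4 * M
    3M+M≈4M = begin-equality
      fromℕ 3 * M + M      ≈⟨ +-comm (fromℕ 3 * M) M ⟩
      M + fromℕ 3 * M      ≈⟨ +-congʳ (*-identityˡ M) ⟨
      1# * M + fromℕ 3 * M ≈⟨ distribʳ M 1# (fromℕ 3) ⟨
      (1# + fromℕ 3) * M   ∎

theorem1 :
  ExcludedMiddle 0ℓ →
  ∃ λ (C : ℕ) →
    ∀ (ℝ : RealNumbers) (L : Logarithm ℝ) →
    let open RealNumbers ℝ
        open Logarithm L in
    ∀ (γ : Carrier) → 0# ≤ γ → γ < 1# →
    ∀ (n m : ℕ) .{{_ : NonZero n}} .{{_ : NonZero m}}
      (R : RMDP ℝ n m) (oracle : DiscRMCOracle ℝ γ R) (selection : ArgMin ℝ n m)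
      (σ⁰ : AgentPolicy ℝ n m) →
    ∃ λ iterations → ∃ λ calls → ∃ λ σ* →
      PolicyIteration.Run ℝ γ R oracle selection σ⁰ iterations calls σ*
      × IsOptimalAgent ℝ γ R σ*
      × fromℕ iterations ≤ fromℕ C * fromℕ n * fromℕ m * (1# ⊔ logRatio γ)
      × fromℕ calls ≤ fromℕ C * fromℕ n * fromℕ m * (1# ⊔ logRatio γ)
-- Each iteration calls the oracle once, so `k` counts both.
theorem1 em = 4 , λ ℝ L γ 0≤γ γ<1 n m R oracle selection σ⁰ →
  let d = record { γ = γ; 0≤γ = 0≤γ; γ<1 = γ<1 }
      ℓ , γˡ⁺¹<1-γ , ℓ≤M = HorizonBound.horizon em ℝ L d
      k , k≤ , σ* , run , optimal =
        PolicyIterationAnalysis.termination em ℝ d R oracle selection (ℕ.suc ℓ) γˡ⁺¹<1-γ σ⁰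
      k≤bound = HorizonBound.iterationBound em ℝ L d n m k≤ ℓ≤M
  in k , k , σ* , run , optimal , k≤bound , k≤bound
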